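{- Let $n$ be a positive integer and let $\mathbf{G}=\{G_1,\dots,G_{2n-1}\}$ be a collection of $2n-1$ (not necessarily distinct) bipartite graphs on the same bipartition $V=(X,Y)$ with $|X|=|Y|=n$. If $\delta(G_i)\geq\left\lceil \frac{n+1}{2}\right\rceil$ for each $i\in[2n-1]$, then one of the following holds: (i) $\mathbf{G}$ is Hamiltonian connected, i.e. for any $x\in X$ and $y\in Y$ there exist a Hamiltonian path $P$ (a path with $V(P)=V$) with endpoints $x$ and $y$ and an injection $\phi:E(P)\to[2n-1]$ with $e\in E(G_{\phi(e)})$ for every $e\in E(P)$; (ii) $n$ is odd and $G_i\in\{F,F'\}$ for each $i\in[2n-1]$, where $F$ and $F'$ are the graphs on $(X,Y)$ defined below.
   Context: $[a]=\{1,\dots,a\}$; $\delta(G)$ is the minimum degree. For odd $n$, $F$ is the balanced bipartite graph with bipartition $(X,Y)$ where $X=\{x^*\}\cup X_1\cup X_2$ with $|X_1|=|X_2|=\frac{n-1}{2}$ and $Y=\{y^*\}\cup Y_1\cup Y_2$ with $|Y_1|=|Y_2|=\frac{n-1}{2}$ (disjoint unions), and $E(F)$ consists of all edges between $x^*$ and $Y_1\cup Y_2$, all edges between $y^*$ and $X_1\cup X_2$, and all edges between $X_i$ and $Y_i$ for $i=1,2$ (and no others). $F'$ is obtained from $F$ by adding the edge $x^*y^*$. Statement (ii) means there is such a choice of $x^*,y^*,X_1,X_2,Y_1,Y_2$ for which every $G_i$ equals $F$ or $F'$. -}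

module Defs where

open import Data.Nat using (ℕ; zero; suc; _+_; _∸_; _≤_; _<_; ⌈_/2⌉; _/_; _%_)
open import Data.Bool using (Bool; true; false)
open import Data.Fin using (Fin; zero; suc; inject₁; fromℕ)
open import Data.Fin.Subset using (Subset; _∈_; _∉_; ∣_∣)
open import Data.Sum using (_⊎_; inj₁; inj₂)
open import Data.Product using (Σ; ∃; _×_; _,_)
open import Function.Definitions using (Injective; Surjective)
open import Relation.Binary.PropositionalEquality using (_≡_)
open import Relation.Nullary using (¬_)
open import Data.Empty using (⊥)

-- A bipartite graph on the fixed bipartition (X , Y) with X = Y = Fin n
-- (two disjoint copies): G x y = true iff x ∈ X is adjacent to y ∈ Y.
BipGraph : ℕ → Set
BipGraph n = Fin n → Fin n → Bool

countTrue : ∀ {n} → (Fin n → Bool) → ℕ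
countTrue {zero} f = 0
countTrue {suc n} f with f zero
... | true  = suc (countTrue (λ i → f (suc i)))
... | false = countTrue (λ i → f (suc i))

degX : ∀ {n} → BipGraph n → Fin n → ℕ
degX G x = countTrue (λ y → G x y)

degY : ∀ {n} → BipGraph n → Fin n → ℕ
degY G y = countTrue (λ x → G x y)

MinDegAtLeast : ∀ {n} → BipGraph n → ℕ → Set
MinDegAtLeast {n} G k = (∀ x → k ≤ degX G x) × (∀ y → k ≤ degY G y)

Vertex : ℕ → Set
Vertex n = Fin n ⊎ Fin n

Adj : ∀ {n} → BipGraph n → Vertex n → Vertex n → Set
Adj G (inj₁ x) (inj₂ y) = G x y ≡ true
Adj G (inj₂ y) (inj₁ x) = G x y ≡ true
Adj G (inj₁ _) (inj₁ _) = ⊥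
Adj G (inj₂ _) (inj₂ _) = ⊥

RainbowHamPath : ∀ {n m} → (Fin m → BipGraph n) → Vertex n → Vertex n → Set
RainbowHamPath {n} {m} Gs u w =
  Σ ℕ λ k → Σ (Fin (suc k) → Vertex n) λ v →
    Injective _≡_ _≡_ v × Surjective _≡_ _≡_ v ×
    v zero ≡ u × v (fromℕ k) ≡ w ×
    Σ (Fin k → Fin m) λ φ → Injective _≡_ _≡_ φ ×
      (∀ (i : Fin k) → Adj (Gs (φ i)) (v (inject₁ i)) (v (suc i)))

HamiltonianConnected : ∀ {n m} → (Fin m → BipGraph n) → Set
HamiltonianConnected {n} Gs = ∀ (x y : Fin n) → RainbowHamPath Gs (inj₁ x) (inj₂ y)

record FData (n : ℕ) : Set where
  field
    xs ys : Fin n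
    X₁ X₂ Y₁ Y₂ : Subset n
    xs∉X₁ : xs ∉ X₁
    xs∉X₂ : xs ∉ X₂
    ys∉Y₁ : ys ∉ Y₁
    ys∉Y₂ : ys ∉ Y₂
    X-disj : ∀ x → x ∈ X₁ → x ∉ X₂
    Y-disj : ∀ y → y ∈ Y₁ → y ∉ Y₂
    X-cover : ∀ x → ¬ (x ≡ xs) → x ∈ X₁ ⊎ x ∈ X₂
    Y-cover : ∀ y → ¬ (y ≡ ys) → y ∈ Y₁ ⊎ y ∈ Y₂
    ∣X₁∣ : ∣ X₁ ∣ ≡ (n ∸ 1) / 2
    ∣X₂∣ : ∣ X₂ ∣ ≡ (n ∸ 1) / 2
    ∣Y₁∣ : ∣ Y₁ ∣ ≡ (n ∸ 1) / 2
    ∣Y₂∣ : ∣ Y₂ ∣ ≡ (n ∸ 1) / 2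

module _ {n : ℕ} (D : FData n) where
  open FData D

  FEdge : Fin n → Fin n → Set
  FEdge x y = (x ≡ xs × (y ∈ Y₁ ⊎ y ∈ Y₂))
            ⊎ (y ≡ ys × (x ∈ X₁ ⊎ x ∈ X₂))
            ⊎ (x ∈ X₁ × y ∈ Y₁)
            ⊎ (x ∈ X₂ × y ∈ Y₂)

  F'Edge : Fin n → Fin n → Set
  F'Edge x y = FEdge x y ⊎ (x ≡ xs × y ≡ ys)

  IsF : BipGraph n → Set
  IsF G = ∀ x y → (G x y ≡ true → FEdge x y) × (FEdge x y → G x y ≡ true)

  IsF' : BipGraph n → Set
  IsF' G = ∀ x y → (G x y ≡ true → F'Edge x y) × (F'Edge x y → G x y ≡ true)

{-# OPTIONS --safe #-}
module Submission where

{-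
Fix x and y, delete them, and put κ = ⌊n/2⌋: the minimum degree is at least κ + 1, and at most 2κ
vertices remain on either side.

(1) Let a cycle through all remaining vertices be rainbow and miss only the colour c, and let its
edges alternate between fs and bs.  If f = ab ∈ fs and aq has the colour of f, then exchanging f
for aq rotates the end q of a path to b without changing the set of colours used; let I(q) be the
set of these f.  If c-coloured and own-coloured edges do not complete the path at once, counting
the degrees of the a's shows that I(q) has on average at least κ elements, plus one if xq ∈ G_c.
Hence some edge wq ∈ bs, of colour d say, has |I(q)| ≥ κ + 1, or even κ + 2 if xq ∈ G_c.  Breaking
the cycle there frees the colours c and d and leaves an end that moves to more than half of Y.  If
wy lies in G_c or G_d, some rotated end is joined to x in the other colour.  Otherwise some
cycle edge e = ab has ay in one and xb in the other of the colours c, d; it is replaced by the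
detour a–y, x–b, and its colour serves to close the cycle between w and a rotated end.

(2) A rainbow Hamiltonian path of the remaining vertices misses two colours.  Either its ends are
joined to y and x in these colours, or their degrees are large enough for Ore's exchange to turn
the path into a cycle as in (1).

(3) Such a path exists after all edges have been added to all graphs.  Remove the added edges one
at a time; losing an edge of the path leaves two segments and three free colours, and exchanges
of Ore's type reconnect the segments unless they span two balanced halves of size κ without edges
between them in any colour.  In that case the degrees force every graph to be F or F'.
-}

open import Data.Bool using (Bool; true; false; not; _∧_)
open import Data.Bool.Properties using (not-injective)
open import Data.Nat using (ℕ; zero; suc; _+_; _*_; _≤_; _<_; z≤n; s≤s; _<?_; _≤?_; _∸_; _/_; _%_; ⌈_/2⌉; ⌊_/2⌋)
open import Data.Nat.DivMod using (m*n/n≡m; [m+kn]%n≡m%n)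
import Data.Nat.Properties as ℕ
open import Data.List using (List; []; _∷_; [_]; _++_; map; length; lookup; allFin; tabulate; cartesianProduct)
open import Data.List.Membership.Propositional using (_∈_)
open import Data.List.Membership.Propositional.Properties using (∈-++⁻; ∈-++⁺ˡ; ∈-++⁺ʳ; ∈-map⁺; ∈-map⁻; ∈-cartesianProduct⁺; ∈-cartesianProduct⁻; ∈-allFin; ∈-lookup)
open import Data.List.Relation.Unary.Any using (here; there)
open import Data.List.Relation.Unary.All as All using (All; []; _∷_)
open import Data.List.Relation.Binary.Permutation.Propositional using (_↭_; ↭⇒↭ₛ; prep; swap; ↭-refl; ↭-sym; ↭-trans; ↭-reflexive)
open import Data.List.Relation.Binary.Permutation.Propositional.Properties using (∈-resp-↭; All-resp-↭; ∷↭∷ʳ; ++-identityʳ; drop-∷; map⁺; ++⁺; ++⁺ˡ; ++⁺ʳ; shift; ++-commutativeMonoid; ↭-length)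
open import Data.Product using (Σ; ∃; _×_; _,_; proj₁; proj₂)
open import Data.Sum as Sum using (_⊎_; inj₁; inj₂)
open import Data.Empty using (⊥; ⊥-elim)
open import Function using (_∘_)
open import Relation.Nullary using (yes; no; does)
open import Relation.Nullary.Decidable using (dec-true; dec-false)
open import Relation.Binary.PropositionalEquality using (_≡_; setoid; refl; sym; trans; cong; cong₂; subst; subst₂; module ≡-Reasoning)
open import Data.List.Properties using (map-++; ++-assoc; length-map; length-++; length-tabulate)
open import Data.List.Relation.Unary.Unique.Propositional using (Unique)
open import Data.List.Relation.Unary.AllPairs using ([]; _∷_)
open import Relation.Binary.Definitions using (DecidableEquality)
import Data.List.Relation.Binary.Permutation.Setoid.Properties as SetoidPermutation
import Data.List.Relation.Unary.All.Properties as Allₚ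
import Data.List.Relation.Unary.Unique.Propositional.Properties as Unique
open import Data.Sum.Properties using (inj₁-injective; inj₂-injective)
open import Data.Fin using (Fin; zero; suc; inject₁; fromℕ)
open import Data.Fin.Properties using (_≟_)
import Data.Fin.Subset as Subset
import Data.Vec as Vec
import Data.Vec.Properties as Vec
open import Defs
import Algebra.Solver.CommutativeMonoid as CommutativeMonoidSolver
open import Data.Nat.Solver using (module +-*-Solver)

-- Finite sums and counting

∑ : {A : Set} → List A → (A → ℕ) → ℕ
∑ []       f = 0
∑ (a ∷ as) f = f a + ∑ as f

𝟙 : Bool → ℕ
𝟙 false = 0
𝟙 true  = 1

𝟙≤1 : ∀ b → 𝟙 b ≤ 1
𝟙≤1 false = z≤n
𝟙≤1 true  = ℕ.≤-refl

drop-𝟙 : ∀ b {m n} → suc m ≤ 𝟙 b + n → m ≤ n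
drop-𝟙 false le       = ℕ.<⇒≤ le
drop-𝟙 true  (s≤s le) = le

count : {A : Set} → (A → Bool) → List A → ℕ
count p as = ∑ as (λ a → 𝟙 (p a))

false≢true : {b : Bool} → b ≡ false → b ≡ true → ⊥
false≢true refl ()

∈⇒↭ : {A : Set} {a : A} {as : List A} → a ∈ as → ∃ λ bs → as ↭ a ∷ bs
∈⇒↭ {as = _ ∷ as} (here refl) = as , ↭-refl
∈⇒↭ {as = b ∷ _} (there a∈as) with ∈⇒↭ a∈as
... | bs , σ = b ∷ bs , ↭-trans (prep b σ) (swap b _ ↭-refl)

+-interchange : ∀ a b c d → (a + b) + (c + d) ≡ (a + c) + (b + d)
+-interchange = +-*-Solver.solve 4 (λ a b c d → (a :+ b) :+ (c :+ d) := (a :+ c) :+ (b :+ d)) refl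
  where open +-*-Solver

module _ {A : Set} where

  ∑-+ : ∀ (as : List A) (f g : A → ℕ) → ∑ as (λ a → f a + g a) ≡ ∑ as f + ∑ as g
  ∑-+ []       f g = refl
  ∑-+ (a ∷ as) f g = trans (cong ((f a + g a) +_) (∑-+ as f g)) (+-interchange (f a) (g a) _ _)

  ∑-const : ∀ (as : List A) k → ∑ as (λ _ → k) ≡ length as * k
  ∑-const []       k = refl
  ∑-const (a ∷ as) k = cong (k +_) (∑-const as k)

module _ {A : Set} where

  ∑-↭ : {as bs : List A} {f : A → ℕ} → as ↭ bs → ∑ as f ≡ ∑ bs f
  ∑-↭ _↭_.refl = refl
  ∑-↭ {f = f} (prep a σ) = cong (f a +_) (∑-↭ σ)
  ∑-↭ {f = f} (swap {as} {bs} a b σ) = begin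
    f a + (f b + ∑ as f) ≡⟨ sym (ℕ.+-assoc (f a) (f b) _) ⟩
    f a + f b + ∑ as f   ≡⟨ cong₂ _+_ (ℕ.+-comm (f a) (f b)) (∑-↭ σ) ⟩
    f b + f a + ∑ bs f   ≡⟨ ℕ.+-assoc (f b) (f a) _ ⟩
    f b + (f a + ∑ bs f) ∎
    where open ≡-Reasoning
  ∑-↭ (_↭_.trans σ τ) = trans (∑-↭ σ) (∑-↭ τ)

  ∑-++ : ∀ (as bs : List A) (f : A → ℕ) → ∑ (as ++ bs) f ≡ ∑ as f + ∑ bs f
  ∑-++ []       bs f = refl
  ∑-++ (a ∷ as) bs f = trans (cong (f a +_) (∑-++ as bs f)) (sym (ℕ.+-assoc (f a) _ _))

  ∑-map : {B : Set} (g : B → A) (bs : List B) (f : A → ℕ) → ∑ (map g bs) f ≡ ∑ bs (f ∘ g)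
  ∑-map g []       f = refl
  ∑-map g (b ∷ bs) f = cong (f (g b) +_) (∑-map g bs f)

  ∑-swap : {B : Set} (as : List A) (bs : List B) (f : A → B → ℕ) →
           ∑ as (λ a → ∑ bs (f a)) ≡ ∑ bs (λ b → ∑ as (λ a → f a b))
  ∑-swap []       bs f = sym (trans (∑-const bs 0) (ℕ.*-zeroʳ (length bs)))
  ∑-swap (a ∷ as) bs f = trans (cong (∑ bs (f a) +_) (∑-swap as bs f)) (sym (∑-+ bs (f a) _))

  ∑-mono : {as : List A} {f g : A → ℕ} → (∀ {a} → a ∈ as → f a ≤ g a) → ∑ as f ≤ ∑ as g
  ∑-mono {[]}     f≤g = z≤n
  ∑-mono {a ∷ as} f≤g = ℕ.+-mono-≤ (f≤g (here refl)) (∑-mono (f≤g ∘ there))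

  ∑-<⇒∃ : (as : List A) {f g : A → ℕ} → ∑ as f < ∑ as g → ∃ λ a → a ∈ as × f a < g a
  ∑-<⇒∃ (a ∷ as) {f} {g} lt with f a <? g a
  ... | yes fa<ga = a , here refl , fa<ga
  ... | no  fa≮ga with ∑-<⇒∃ as (ℕ.+-cancelˡ-< (f a) _ _
                       (ℕ.<-≤-trans lt (ℕ.+-monoˡ-≤ _ (ℕ.≮⇒≥ fa≮ga))))
  ...   | b , b∈as , fb<gb = b , there b∈as , fb<gb

  ∑-≤⇒∃ : {as : List A} {f g : A → ℕ} {a₀ : A} → ∑ as f ≤ ∑ as g → a₀ ∈ as → g a₀ < f a₀ →
          ∃ λ a → a ∈ as × f a < g a
  ∑-≤⇒∃ {as} {f} {g} {a₀} le a₀∈as lt with ∈⇒↭ a₀∈as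
  ... | bs , σ with ∑-<⇒∃ bs {f} {g} (ℕ.+-cancelˡ-< (g a₀) _ _
                      (ℕ.<-≤-trans (ℕ.+-monoˡ-< (∑ bs f) lt) (subst₂ _≤_ (∑-↭ σ) (∑-↭ σ) le)))
  ...   | b , b∈bs , fb<gb = b , ∈-resp-↭ (↭-sym σ) (there b∈bs) , fb<gb

  count-↭ : {as bs : List A} {p : A → Bool} → as ↭ bs → count p as ≡ count p bs
  count-↭ = ∑-↭

  count-drop : ∀ {as bs : List A} {p : A → Bool} {a} → as ↭ a ∷ bs → p a ≡ false → count p as ≡ count p bs
  count-drop {bs = bs} {p} σ ¬pa = trans (count-↭ σ) (cong (λ b → 𝟙 b + count p bs) ¬pa)

  count-++ : ∀ (p : A → Bool) as bs → count p (as ++ bs) ≡ count p as + count p bs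
  count-++ p as bs = ∑-++ as bs _

  count-none : ∀ {p : A → Bool} {as} → (∀ {a} → a ∈ as → p a ≡ false) → count p as ≡ 0
  count-none {as = []}     none = refl
  count-none {as = a ∷ as} none rewrite none (here refl) = count-none (none ∘ there)

  count-only : ∀ {as bs cs : List A} {p : A → Bool} → as ↭ bs ++ cs → (∀ {c} → c ∈ cs → p c ≡ false) →
               count p as ≡ count p bs
  count-only {bs = bs} {cs} {p} σ none = trans (count-↭ σ) (trans (count-++ p bs cs)
    (trans (cong (count p bs +_) (count-none none)) (ℕ.+-identityʳ _)))

  count≤length : ∀ (p : A → Bool) as → count p as ≤ length as
  count≤length p []       = z≤n
  count≤length p (a ∷ as) with p a
  ... | true  = s≤s (count≤length p as)
  ... | false = ℕ.m≤n⇒m≤1+n (count≤length p as)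

  private
    length≡∑ : (as : List A) → length as ≡ ∑ as (λ _ → 1)
    length≡∑ as = sym (trans (∑-const as 1) (ℕ.*-identityʳ _))

    both : ∀ {b c} → 1 < 𝟙 b + 𝟙 c → b ≡ true × c ≡ true
    both {false} {false} ()
    both {false} {true}  (s≤s ())
    both {true}  {false} (s≤s ())
    both {true}  {true}  _ = refl , refl

  pigeonhole : ∀ {as} {p q : A → Bool} → length as < count p as + count q as →
               ∃ λ a → a ∈ as × p a ≡ true × q a ≡ true
  pigeonhole {as} lt with ∑-<⇒∃ as (subst₂ _<_ (length≡∑ as) (sym (∑-+ as _ _)) lt)
  ... | a , a∈as , lt′ = a , a∈as , both lt′

  -- No element contributes 2 to the right-hand side, so none can contribute 0.
  pigeonhole-tight : ∀ {as} {p q : A → Bool} → length as ≤ count p as + count q as →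
                     (∀ {a} → a ∈ as → p a ≡ true → q a ≡ true → ⊥) →
                     ∀ {a} → a ∈ as → p a ≡ not (q a)
  pigeonhole-tight {as} {p} {q} le disjoint {a} a∈as with p a in pa | q a in qa
  ... | true  | true  = ⊥-elim (disjoint a∈as pa qa)
  ... | true  | false = refl
  ... | false | true  = refl
  ... | false | false with ∑-≤⇒∃ (subst₂ _≤_ (length≡∑ as) (sym (∑-+ as _ _)) le) a∈as
                             (subst₂ (λ b c → 𝟙 b + 𝟙 c < 1) (sym pa) (sym qa) (s≤s z≤n))
  ...   | b , b∈as , lt = ⊥-elim (disjoint b∈as (proj₁ (both lt)) (proj₂ (both lt)))

  count-all : ∀ {as} {p : A → Bool} → length as ≤ count p as → ∀ {a} → a ∈ as → p a ≡ true
  count-all {as} {p} le {a} a∈as with p a in pa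
  ... | true  = refl
  ... | false with ∑-≤⇒∃ (subst (_≤ count p as) (length≡∑ as) le) a∈as
                     (subst (λ b → 𝟙 b < 1) (sym pa) (s≤s z≤n))
  ...   | b , _ , lt with p b
  ...     | true  = ⊥-elim (ℕ.<-irrefl refl lt)
  ...     | false with () ← lt

  search : ∀ (p : A → Bool) as → (∃ λ a → a ∈ as × p a ≡ true) ⊎ (∀ {a} → a ∈ as → p a ≡ false)
  search p [] = inj₂ λ ()
  search p (a ∷ as) with p a in pa
  ... | true  = inj₁ (a , here refl , pa)
  ... | false with search p as
  ...   | inj₁ (b , b∈as , pb) = inj₁ (b , there b∈as , pb)
  ...   | inj₂ none            = inj₂ λ { (here refl) → pa ; (there b∈as) → none b∈as }

  search₂ : ∀ (p q : A → Bool) as →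
            (∃ λ a → a ∈ as × p a ≡ true × q a ≡ true) ⊎ (∀ {a} → a ∈ as → p a ≡ true → q a ≡ true → ⊥)
  search₂ p q as with search (λ a → p a ∧ q a) as
  ... | inj₂ none = inj₂ λ a∈ pa qa → false≢true (none a∈) (cong₂ _∧_ pa qa)
  ... | inj₁ (a , a∈ , pq) = inj₁ (a , a∈ , ∧-true pq)
    where
    ∧-true : ∀ {b c} → b ∧ c ≡ true → b ≡ true × c ≡ true
    ∧-true {true} {true} _ = refl , refl

all-or-first : {A P : Set} {Q : A → Set} (as : List A) → (∀ {a} → a ∈ as → P ⊎ Q a) → P ⊎ (∀ {a} → a ∈ as → Q a)
all-or-first []       each = inj₂ λ ()
all-or-first (a ∷ as) each with each (here refl) | all-or-first as (each ∘ there)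
... | inj₁ p | _      = inj₁ p
... | inj₂ _ | inj₁ p = inj₁ p
... | inj₂ q | inj₂ r = inj₂ λ { (here refl) → q ; (there a∈) → r a∈ }

Unique-resp-↭ : {A : Set} {as bs : List A} → as ↭ bs → Unique as → Unique bs
Unique-resp-↭ {A} σ = SetoidPermutation.Unique-resp-↭ (setoid A) (↭⇒↭ₛ σ)

-- Alternating walks and their edge exchanges

module Walks (C X Y : Set) where

  record Edge : Set where
    constructor edge
    field
      col : C
      src : X
      tgt : Y
  open Edge public

  colours : List Edge → List C
  colours = map col

  srcs : List Edge → List X
  srcs = map src

  tgts : List Edge → List Y
  tgts = map tgt

  -- Walk u v fs bs is a walk from u to v that traverses the edges fs from X to Y and
  -- the edges bs from Y to X; both lists only matter up to order.
  data Walk : X ⊎ Y → X ⊎ Y → List Edge → List Edge → Set where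
    stop : ∀ {u} → Walk u u [] []
    fwd  : ∀ e {v fs bs} → Walk (inj₂ (tgt e)) v fs bs → Walk (inj₁ (src e)) v (e ∷ fs) bs
    bwd  : ∀ e {v fs bs} → Walk (inj₁ (src e)) v fs bs → Walk (inj₂ (tgt e)) v fs (e ∷ bs)
    perm : ∀ {u v fs fs′ bs bs′} → fs ↭ fs′ → bs ↭ bs′ → Walk u v fs bs → Walk u v fs′ bs′

  infixr 5 _⊙_

  _⊙_ : ∀ {u v w fs bs fs′ bs′} → Walk u v fs bs → Walk v w fs′ bs′ → Walk u w (fs ++ fs′) (bs ++ bs′)
  stop       ⊙ V = V
  fwd e W    ⊙ V = fwd e (W ⊙ V)
  bwd e W    ⊙ V = bwd e (W ⊙ V)
  perm σ τ W ⊙ V = perm (++⁺ʳ _ σ) (++⁺ʳ _ τ) (W ⊙ V)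

  rev : ∀ {u v fs bs} → Walk u v fs bs → Walk v u bs fs
  rev stop = stop
  rev (fwd e {fs = fs} {bs} W) = perm (++-identityʳ bs) (↭-sym (∷↭∷ʳ e fs)) (rev W ⊙ bwd e stop)
  rev (bwd e {fs = fs} {bs} W) = perm (↭-sym (∷↭∷ʳ e bs)) (++-identityʳ fs) (rev W ⊙ fwd e stop)
  rev (perm σ τ W) = perm τ σ (rev W)

  record Split (u v : X ⊎ Y) (e : Edge) (fs bs : List Edge) : Set where
    constructor split
    field
      {fs₁ bs₁ fs₂ bs₂} : List Edge
      before : Walk u (inj₁ (src e)) fs₁ bs₁
      after  : Walk (inj₂ (tgt e)) v fs₂ bs₂
      fs↭    : fs ↭ e ∷ fs₁ ++ fs₂
      bs↭    : bs ↭ bs₁ ++ bs₂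

  split-at : ∀ {u v e fs bs} → Walk u v fs bs → e ∈ fs → Split u v e fs bs
  split-at (fwd e W) (here refl) = split stop W ↭-refl ↭-refl
  split-at (fwd e W) (there e∈) with split-at W e∈
  ... | split B A σ τ = split (fwd e B) A (↭-trans (prep e σ) (swap e _ ↭-refl)) τ
  split-at (bwd e W) e∈ with split-at W e∈
  ... | split B A σ τ = split (bwd e B) A σ (prep e τ)
  split-at (perm σ τ W) e∈ with split-at W (∈-resp-↭ (↭-sym σ) e∈)
  ... | split B A σ′ τ′ = split B A (↭-trans (↭-sym σ) σ′) (↭-trans (↭-sym τ) τ′)

  endX : X ⊎ Y → List X
  endX (inj₁ a) = [ a ]
  endX (inj₂ _) = []

  endY : X ⊎ Y → List Y
  endY (inj₁ _) = []
  endY (inj₂ b) = [ b ]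

  -- Each visit to `X` begins at the start or by an edge of `bs` and finishes at the end or by an
  -- edge of `fs`; the two sides list the visits in these two ways.
  balance-src : ∀ {u v fs bs} → Walk u v fs bs → srcs fs ++ endX v ↭ endX u ++ srcs bs
  balance-src {v = v} stop = ↭-sym (++-identityʳ (endX v))
  balance-src (fwd e W) = prep (src e) (balance-src W)
  balance-src (bwd e W) = balance-src W
  balance-src {u} {v} (perm σ τ W) =
    ↭-trans (++⁺ʳ (endX v) (map⁺ src (↭-sym σ))) (↭-trans (balance-src W) (++⁺ˡ (endX u) (map⁺ src τ)))

  balance-tgt : ∀ {u v fs bs} → Walk u v fs bs → tgts bs ++ endY v ↭ endY u ++ tgts fs
  balance-tgt {v = v} stop = ↭-sym (++-identityʳ (endY v))
  balance-tgt (fwd e W) = balance-tgt W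
  balance-tgt (bwd e W) = prep (tgt e) (balance-tgt W)
  balance-tgt {u} {v} (perm σ τ W) =
    ↭-trans (++⁺ʳ (endY v) (map⁺ tgt (↭-sym τ))) (↭-trans (balance-tgt W) (++⁺ˡ (endY u) (map⁺ tgt σ)))

  -- On a walk from `X` to `Y` every visit lies on exactly one forward edge, so for a Hamiltonian
  -- path `fs` is a perfect matching. Neighbour counts can then be moved between vertices and edges
  -- of `fs`.
  record Spans (fs : List Edge) (xs : List X) (ys : List Y) : Set where
    constructor spans
    field
      srcs↭ : srcs fs ↭ xs
      tgts↭ : tgts fs ↭ ys

  -- xs and ys are the vertices visited; the directions in which the edges es are traversed are forgotten.
  record Path (a : X) (b : Y) (xs : List X) (ys : List Y) (es : List Edge) : Set where
    constructor path
    field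
      {fs bs} : List Edge
      walk : Walk (inj₁ a) (inj₂ b) fs bs
      span : Spans fs xs ys
      es↭  : fs ++ bs ↭ es

  -- By balance, `a ∷ srcs bs` and `tgts bs ++ [ b ]` list the vertices of the new walk, so only
  -- these have to be compared with the old matching `fs₀`.
  spans-walk : ∀ {a b fs bs fs₀} → Walk (inj₁ a) (inj₂ b) fs bs →
               (a ∷ srcs bs) ↭ srcs fs₀ → (tgts bs ++ [ b ]) ↭ tgts fs₀ →
               ∀ {xs ys} → Spans fs₀ xs ys → Spans fs xs ys
  spans-walk W σ τ (spans σ′ τ′) =
    spans (↭-trans (↭-sym (++-identityʳ _)) (↭-trans (balance-src W) (↭-trans σ σ′)))
          (↭-trans (↭-sym (balance-tgt W)) (↭-trans τ τ′))

  module _ {A : Set} where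
    open CommutativeMonoidSolver (++-commutativeMonoid {A = A})

    ++-rotate : (as bs : List A) → as ++ bs ↭ bs ++ as
    ++-rotate as bs = solve 2 (λ a b → a ⊕ b ⊜ b ⊕ a) ↭-refl as bs

    reclose↭ : (e g : A) (f₁ b₁ f₂ b₂ : List A) →
               g ∷ ((e ∷ f₁ ++ f₂) ++ (b₁ ++ b₂)) ↭ e ∷ ((b₂ ++ g ∷ b₁) ++ (f₂ ++ f₁))
    reclose↭ e g = solve 6 (λ e g f₁ b₁ f₂ b₂ → g ⊕ ((e ⊕ f₁ ⊕ f₂) ⊕ (b₁ ⊕ b₂)) ⊜
                                                e ⊕ ((b₂ ⊕ g ⊕ b₁) ⊕ (f₂ ⊕ f₁))) ↭-refl [ e ] [ g ]

    reclose′↭ : (e g : A) (f₁ b₁ f₂ b₂ : List A) →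
                g ∷ ((f₁ ++ f₂) ++ (e ∷ b₁ ++ b₂)) ↭ e ∷ ((f₂ ++ f₁) ++ (b₂ ++ g ∷ b₁))
    reclose′↭ e g = solve 6 (λ e g f₁ b₁ f₂ b₂ → g ⊕ ((f₁ ⊕ f₂) ⊕ (e ⊕ b₁ ⊕ b₂)) ⊜
                                                e ⊕ ((f₂ ⊕ f₁) ⊕ (b₂ ⊕ g ⊕ b₁))) ↭-refl [ e ] [ g ]

    rotate↭ : (e : A) (f₁ b₁ f₂ b₂ : List A) →
              (f₁ ++ e ∷ b₂) ++ (b₁ ++ f₂) ↭ e ∷ ((f₁ ++ f₂) ++ (b₁ ++ b₂))
    rotate↭ e = solve 5 (λ e f₁ b₁ f₂ b₂ → (f₁ ⊕ e ⊕ b₂) ⊕ (b₁ ⊕ f₂) ⊜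
                                          e ⊕ ((f₁ ⊕ f₂) ⊕ (b₁ ⊕ b₂))) ↭-refl [ e ]

    cross↭ : (g h : A) (f₁ b₁ f₂ b₂ : List A) →
             (b₁ ++ g ∷ f₂) ++ (h ∷ f₁ ++ b₂) ↭ g ∷ h ∷ ((f₁ ++ f₂) ++ (b₁ ++ b₂))
    cross↭ g h = solve 6 (λ g h f₁ b₁ f₂ b₂ → (b₁ ⊕ g ⊕ f₂) ⊕ (h ⊕ f₁ ⊕ b₂) ⊜
                                        g ⊕ h ⊕ ((f₁ ⊕ f₂) ⊕ (b₁ ⊕ b₂))) ↭-refl [ g ] [ h ]

  map-++⁺ʳ : ∀ {A : Set} {g : Edge → A} {as bs} cs → map g as ↭ map g bs → map g (as ++ cs) ↭ map g (bs ++ cs)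
  map-++⁺ʳ {g = g} {as} {bs} cs σ =
    ↭-trans (↭-reflexive (map-++ g as cs)) (↭-trans (++⁺ʳ (map g cs) σ) (↭-reflexive (sym (map-++ g bs cs))))

  -- An edge between the ends turns the path into a cycle, which is opened again at `e`.
  reclose : ∀ {w q xs ys es e} → Path w q xs ys es → ∀ c → e ∈ es →
            ∃ λ es′ → Path (src e) (tgt e) xs ys es′ × edge c w q ∷ es ↭ e ∷ es′
  reclose {w} {q} {es = es} {e} (path {fs} {bs} W sp es↭) c e∈es
    with ∈-++⁻ fs (∈-resp-↭ (↭-sym es↭) e∈es)
  ... | inj₁ e∈fs with split-at W e∈fs
  ...   | split {f₁} {b₁} {f₂} {b₂} B A σ τ =
      _ , path V (spans-walk V (map⁺ src (↭-trans (prep e (++-rotate f₂ f₁)) (↭-sym σ)))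
                      (↭-trans (↭-sym (∷↭∷ʳ (tgt e) _)) (map⁺ tgt (↭-trans (prep e (++-rotate f₂ f₁)) (↭-sym σ)))) sp)
               ↭-refl
        , ↭-trans (prep _ (↭-trans (↭-sym es↭) (++⁺ σ τ))) (reclose↭ e (edge c w q) f₁ b₁ f₂ b₂)
    -- Here `e` was traversed forwards, so the new path runs against the old direction and the two
    -- edge classes change places.
    where V = rev (A ⊙ bwd (edge c w q) B)
  reclose {w} {q} {es = es} {e} (path {fs} {bs} W sp es↭) c e∈es
      | inj₂ e∈bs with split-at (rev W) e∈bs
  ...   | split {b₂} {f₂} {b₁} {f₁} B A σ τ =
      _ , path V (spans-rotate sp) ↭-refl
        , ↭-trans (prep _ (↭-trans (↭-sym es↭)
            (++⁺ (↭-trans τ (++-rotate f₂ f₁)) (↭-trans σ (prep e (++-rotate b₂ b₁))))))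
            (reclose′↭ e (edge c w q) f₁ b₁ f₂ b₂)
    where
    V = rev B ⊙ bwd (edge c w q) (rev A)
    spans-rotate : ∀ {xs ys} → Spans fs xs ys → Spans (f₂ ++ f₁) xs ys
    spans-rotate (spans σ′ τ′) = spans (↭-trans (map⁺ src (↭-sym τ)) σ′) (↭-trans (map⁺ tgt (↭-sym τ)) τ′)

  -- Pósa's rotation: the stretch from `tgt f` to `q` is run through backwards. The new edge
  -- inherits the colour of `f`, which keeps the colours used.
  rotate : ∀ {w q xs ys fs bs f fs′} → Walk (inj₁ w) (inj₂ q) fs bs → Spans fs xs ys → fs ↭ f ∷ fs′ →
           Path w (tgt f) xs ys (edge (col f) (src f) q ∷ fs′ ++ bs)
  rotate {w} {q} {fs = fs} {f = f} {fs′} W sp σ with split-at W (∈-resp-↭ (↭-sym σ) (here refl))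
  ... | split {f₁} {b₁} {f₂} {b₂} B A ρ τ =
    path V (spans-walk V
             (↭-trans (↭-reflexive (cong (w ∷_) (map-++ src b₁ f₂)))
               (↭-trans (++⁺ʳ (srcs f₂) (↭-trans (↭-sym (balance-src B)) (↭-sym (∷↭∷ʳ (src f) (srcs f₁)))))
                 (↭-trans (↭-reflexive (cong (src f ∷_) (sym (map-++ src f₁ f₂)))) (map⁺ src (↭-sym ρ)))))
             (↭-trans (↭-sym (∷↭∷ʳ (tgt f) _))
               (↭-trans (prep (tgt f) (map-++⁺ʳ f₂ (↭-trans (↭-sym (++-identityʳ _)) (balance-tgt B))))
                 (map⁺ tgt (↭-sym ρ)))) sp)
      (↭-trans (rotate↭ (edge (col f) (src f) q) f₁ b₁ f₂ b₂)
               (prep _ (++⁺ (drop-∷ (↭-trans (↭-sym ρ) σ)) (↭-sym τ))))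
    where V = B ⊙ fwd (edge (col f) (src f) q) (rev A)

  -- Cycle fs bs is a closed walk whose edges alternate between fs and bs.
  record Cycle (fs bs : List Edge) : Set where
    constructor cycle
    field
      {closing} : Edge
      {bs′}     : List Edge
      open-walk : Walk (inj₁ (src closing)) (inj₂ (tgt closing)) fs bs′
      bs↭       : bs ↭ closing ∷ bs′

  -- A cycle is stored cut open at `closing`. To cut it at another edge of `bs`, the two remaining
  -- stretches are rejoined through `closing`, with `fs` kept as the forward class.
  break : ∀ {fs bs e} → Cycle fs bs → e ∈ bs →
          ∃ λ bs′ → Walk (inj₁ (src e)) (inj₂ (tgt e)) fs bs′ × bs ↭ e ∷ bs′
  break (cycle {g} W σ) e∈bs with ∈-resp-↭ σ e∈bs
  ... | here refl = _ , W , σ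
  ... | there e∈bs′ with split-at (rev W) e∈bs′
  ...   | split {b₂} {f₂} {b₁} {f₁} B A ρ τ =
      _ , perm (↭-sym τ) ↭-refl (rev B ⊙ bwd g (rev A))
        , ↭-trans σ (↭-trans (prep g ρ) (↭-trans (swap g _ ↭-refl) (prep _ (↭-sym (shift g b₂ b₁)))))

  -- Cut open at `e` and traversed the other way round, the same cycle has `bs` as its forward
  -- class.
  flip-cycle : ∀ {fs bs e} → Cycle fs bs → e ∈ fs → Cycle bs fs
  flip-cycle (cycle {g} W σ) e∈fs with split-at W e∈fs
  ... | split {f₁} {b₁} {f₂} {b₂} B A ρ τ =
    cycle (perm ↭-refl (++-rotate f₂ f₁)
             (perm (↭-trans (shift g b₂ b₁) (↭-trans (prep g (↭-trans (++-rotate b₂ b₁) (↭-sym τ))) (↭-sym σ))) ↭-refl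
               (rev (A ⊙ bwd g B)))) ρ

  cycle-srcs : ∀ {fs bs} → Cycle fs bs → srcs bs ↭ srcs fs
  cycle-srcs (cycle W σ) = ↭-trans (map⁺ src σ) (↭-trans (↭-sym (balance-src W)) (++-identityʳ _))

  cycle-tgts : ∀ {fs bs} → Cycle fs bs → tgts bs ↭ tgts fs
  cycle-tgts (cycle {g} W σ) = ↭-trans (map⁺ tgt σ) (↭-trans (∷↭∷ʳ (tgt g) _) (balance-tgt W))

  close : ∀ {w q fs bs} → Walk (inj₁ w) (inj₂ q) fs bs → ∀ c → Cycle fs (edge c w q ∷ bs)
  close W c = cycle W ↭-refl

  record Crossing (w : X) (q : Y) (f : Edge) (c d : C) (fs bs fs′ : List Edge) : Set where
    constructor crossing
    field
      {fs″ bs″} : List Edge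
      closed    : Cycle fs″ bs″
      span      : ∀ {xs ys} → Spans fs xs ys → Spans fs″ xs ys
      es↭       : fs″ ++ bs″ ↭ edge c w (tgt f) ∷ edge d (src f) q ∷ fs′ ++ bs

  -- Ore's exchange: the edges w–tgt f and src f–q replace f and the gap between the ends.
  cross : ∀ {w q fs bs f fs′} → Walk (inj₁ w) (inj₂ q) fs bs → fs ↭ f ∷ fs′ → ∀ c d →
          Crossing w q f c d fs bs fs′
  cross {w} {q} {fs = fs} {f = f} {fs′} W σ c d with split-at W (∈-resp-↭ (↭-sym σ) (here refl))
  ... | split {f₁} {b₁} {f₂} {b₂} B A ρ τ =
    crossing (close V d)
      (spans-walk V
        (↭-trans (prep (src f) (map-++ʳ-src)) (map⁺ src (↭-sym ρ)))
        (↭-trans (++⁺ʳ [ q ] (↭-reflexive (map-++ tgt f₁ b₂)))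
          (↭-trans (↭-reflexive (++-assoc (tgts f₁) (tgts b₂) [ q ]))
            (↭-trans (++⁺ˡ (tgts f₁) (balance-tgt A))
              (↭-trans (shift (tgt f) (tgts f₁) (tgts f₂))
                (↭-trans (↭-reflexive (cong (tgt f ∷_) (sym (map-++ tgt f₁ f₂)))) (map⁺ tgt (↭-sym ρ))))))))
      (↭-trans (cross↭ (edge c w (tgt f)) (edge d (src f) q) f₁ b₁ f₂ b₂)
               (prep _ (prep _ (++⁺ (drop-∷ (↭-trans (↭-sym ρ) σ)) (↭-sym τ)))))
    where
    V = rev B ⊙ fwd (edge c w (tgt f)) A
    map-++ʳ-src : srcs (f₁ ++ b₂) ↭ srcs (f₁ ++ f₂)
    map-++ʳ-src = ↭-trans (↭-reflexive (map-++ src f₁ b₂)) (↭-trans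
      (++⁺ˡ (srcs f₁) (↭-trans (↭-sym (balance-src A)) (++-identityʳ _))) (↭-reflexive (sym (map-++ src f₁ f₂))))

-- Labels and counts along walks

module Labelling (C X Y : Set) (p : X → Bool) (q : Y → Bool) where
  open Walks C X Y

  label : X ⊎ Y → Bool
  label (inj₁ a) = p a
  label (inj₂ b) = q b

  constant-along : ∀ {u v fs bs} → Walk u v fs bs →
                   (∀ {e} → e ∈ fs → p (src e) ≡ q (tgt e)) →
                   (∀ {e} → e ∈ bs → p (src e) ≡ q (tgt e)) →
                   ∀ {e} → e ∈ fs → p (src e) ≡ label u
  constant-along (fwd e W) F B (here refl)  = refl
  constant-along (fwd e W) F B (there e∈) = trans (constant-along W (F ∘ there) B e∈) (sym (F (here refl)))
  constant-along (bwd e W) F B e∈ = trans (constant-along W F (B ∘ there) e∈) (B (here refl))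
  constant-along (perm σ τ W) F B e∈ =
    constant-along W (F ∘ ∈-resp-↭ σ) (B ∘ ∈-resp-↭ τ) (∈-resp-↭ (↭-sym σ) e∈)

module Counting (C X Y : Set) where
  open Walks C X Y public

  count-src : ∀ {fs xs ys} (p : X → Bool) → Spans fs xs ys → count p xs ≡ count (p ∘ src) fs
  count-src {fs} p (spans σ _) = trans (count-↭ (↭-sym σ)) (∑-map src fs _)

  count-tgt : ∀ {fs xs ys} (q : Y → Bool) → Spans fs xs ys → count q ys ≡ count (q ∘ tgt) fs
  count-tgt {fs} q (spans _ τ) = trans (count-↭ (↭-sym τ)) (∑-map tgt fs _)

  length-tgt : ∀ {fs xs ys} → Spans fs xs ys → length fs ≡ length ys
  length-tgt {fs} (spans _ τ) = trans (sym (length-map tgt fs)) (↭-length τ)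

  length-src : ∀ {fs xs ys} → Spans fs xs ys → length fs ≡ length xs
  length-src {fs} (spans σ _) = trans (sym (length-map src fs)) (↭-length σ)

  spans-other : ∀ {fs bs xs ys} → Cycle fs bs → Spans fs xs ys → Spans bs xs ys
  spans-other cyc (spans σ τ) = spans (↭-trans (cycle-srcs cyc) σ) (↭-trans (cycle-tgts cyc) τ)

  -- Otherwise exactly one of p and q would hold on every edge, so that p and not ∘ q would
  -- together be constant along the cycle.
  meeting-edge : ∀ {fs bs xs ys} → Cycle fs bs → Spans fs xs ys → (p : X → Bool) (q : Y → Bool) →
                 length ys ≤ count p xs + count q ys → 0 < count p xs → 0 < count q ys →
                 ∃ λ e → (e ∈ fs ⊎ e ∈ bs) × p (src e) ≡ true × q (tgt e) ≡ true
  meeting-edge {fs} {bs} {xs} {ys} cyc@(cycle {g} W τ) sp p q le p≢∅ q≢∅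
    with search₂ (p ∘ src) (q ∘ tgt) fs | search₂ (p ∘ src) (q ∘ tgt) bs
  ... | inj₁ (e , e∈fs , pq) | _ = e , inj₁ e∈fs , pq
  ... | inj₂ _ | inj₁ (e , e∈bs , pq) = e , inj₂ e∈bs , pq
  ... | inj₂ noF | inj₂ noB = ⊥-elim (absurd (p (src g)) refl)
    where
    alternate : ∀ {es} → Spans es xs ys → (∀ {e} → e ∈ es → p (src e) ≡ true → q (tgt e) ≡ true → ⊥) →
                ∀ {e} → e ∈ es → p (src e) ≡ not (q (tgt e))
    alternate {es} sp′ none = pigeonhole-tight
      (subst₂ _≤_ (sym (length-tgt sp′)) (cong₂ _+_ (count-src p sp′) (count-tgt q sp′)) le) none

    F : ∀ {e} → e ∈ fs → p (src e) ≡ not (q (tgt e))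
    F = alternate sp noF

    open Labelling C X Y p (not ∘ q)

    const : ∀ {e} → e ∈ fs → p (src e) ≡ p (src g)
    const = constant-along W F (alternate (spans-other cyc sp) noB ∘ ∈-resp-↭ (↭-sym τ) ∘ there)

    absurd : ∀ b → p (src g) ≡ b → ⊥
    absurd false eq = ℕ.<-irrefl (sym (trans (count-src p sp) (count-none (λ e∈ → trans (const e∈) eq)))) p≢∅
    absurd true  eq = ℕ.<-irrefl (sym (trans (count-tgt q sp) (count-none (λ e∈ → not-injective
                        (trans (sym (F e∈)) (trans (const e∈) eq)))))) q≢∅

-- Completing a rainbow Hamiltonian cycle that avoids x and y

module Completion
  (C X Y : Set) (G : C → X → Y → Bool)
  (Xs : List X) (Ys : List Y) (Cs : List C) (x : X) (y : Y) (κ : ℕ)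
  (0<κ : 0 < κ) (|Ys|≤2κ : length Ys ≤ κ + κ)
  (degX : ∀ c {a} → a ∈ Xs → suc κ ≤ 𝟙 (G c a y) + count (G c a) Ys)
  (degY : ∀ c {b} → b ∈ Ys → suc κ ≤ 𝟙 (G c x b) + count (λ a → G c a b) Xs)
  (degx : ∀ c → κ ≤ count (G c x) Ys)
  (degy : ∀ c → κ ≤ count (λ a → G c a y) Xs)
  where
  open Counting C X Y

  Valid : Edge → Set
  Valid e = G (col e) (src e) (tgt e) ≡ true

  -- Prolonged by the edges a–y and x–b, the path becomes a rainbow Hamiltonian path from x to y.
  record Completed : Set where
    constructor completed
    field
      {a}  : X
      {b}  : Y
      {es} : List Edge
      {α β} : C
      inner   : Path a b Xs Ys es
      valid   : All Valid es
      rainbow : α ∷ β ∷ colours es ↭ Cs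
      a∼y     : G α a y ≡ true
      x∼b     : G β x b ≡ true

  record RainbowCycle (fs bs : List Edge) (c : C) : Set where
    constructor rainbowCycle
    field
      cyc     : Cycle fs bs
      span    : Spans fs Xs Ys
      valid   : All Valid (fs ++ bs)
      rainbow : c ∷ colours (fs ++ bs) ↭ Cs

  deg≥κ : ∀ c {a} → a ∈ Xs → κ ≤ count (G c a) Ys
  deg≥κ c a∈Xs = drop-𝟙 _ (degX c a∈Xs)

  module _ {fs bs : List Edge} {c : C} (R : RainbowCycle fs bs c) where
    open RainbowCycle R

    span-bs : Spans bs Xs Ys
    span-bs = spans-other cyc span

    flip-rainbow : ∀ {e} → e ∈ fs → RainbowCycle bs fs c
    flip-rainbow e∈fs = rainbowCycle (flip-cycle cyc e∈fs) span-bs (All-resp-↭ σ valid)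
                                     (↭-trans (prep c (map⁺ col (↭-sym σ))) rainbow)
      where σ = ++-rotate fs bs

    -- Breaking the cycle at `e` frees its colour for the edge to `y`; the missing colour `c` serves
    -- for the edge to `x`.
    straight : ∀ {e} → e ∈ bs → G (col e) (src e) y ≡ true → G c x (tgt e) ≡ true → Completed
    straight {e} e∈bs a∼y x∼b with break cyc e∈bs
    ... | bs′ , W , τ = completed (path W span ↭-refl) (All.tail (All-resp-↭ σ valid))
                          (↭-trans (swap (col e) c ↭-refl) (↭-trans (prep c (map⁺ col (↭-sym σ))) rainbow)) a∼y x∼b
      where
      σ : fs ++ bs ↭ e ∷ fs ++ bs′
      σ = ↭-trans (++⁺ˡ fs τ) (shift e fs bs′)

    -- The edges f ∈ fs that rotate the end b of a path to tgt f without changing the colours used.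
    own : Y → Edge → Bool
    own b f = G (col f) (src f) b

    module _ {β : Edge} {bs′ : List Edge} (W : Walk (inj₁ (src β)) (inj₂ (tgt β)) fs bs′)
             (bs↭ : bs ↭ β ∷ bs′) where

      src∈ : src β ∈ Xs
      src∈ = ∈-resp-↭ (Spans.srcs↭ span-bs) (∈-map⁺ src (∈-resp-↭ (↭-sym bs↭) (here refl)))

      module _ {f : Edge} {fs′ : List Edge} (fs↭ : fs ↭ f ∷ fs′) (f-own : own (tgt β) f ≡ true) where

        rotated : List Edge
        rotated = edge (col f) (src f) (tgt β) ∷ fs′ ++ bs′

        rotated-path : Path (src β) (tgt f) Xs Ys rotated
        rotated-path = rotate W span fs↭

        private
          σ : fs ++ bs ↭ β ∷ f ∷ fs′ ++ bs′
          σ = ↭-trans (++⁺ fs↭ bs↭) (shift β (f ∷ fs′) bs′)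

        rotated-valid : All Valid rotated
        rotated-valid = f-own ∷ All.tail (All.tail (All-resp-↭ σ valid))

        -- The free colours of the rotated path are `c` and that of `β`; `π` decides which of them
        -- goes to `y` and which to `x`.
        rotated-rainbow : ∀ {α α′} → α ∷ [ α′ ] ↭ c ∷ [ col β ] → α ∷ α′ ∷ colours rotated ↭ Cs
        rotated-rainbow π = ↭-trans (++⁺ʳ (colours rotated) π) (↭-trans (prep c (map⁺ col (↭-sym σ))) rainbow)

        -- The edge between `src β` and `tgt f` takes over the colour of `e`. It closes the rotated
        -- path to a cycle, which is opened at `e`, and the two free colours attach the ends of `e`
        -- to `y` and `x`.
        detour : ∀ {e α α′} → α ∷ [ α′ ] ↭ c ∷ [ col β ] → e ∈ fs′ ++ bs′ →
                 G (col e) (src β) (tgt f) ≡ true →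
                 G α (src e) y ≡ true → G α′ x (tgt e) ≡ true → Completed
        detour {e} π e∈ closing a∼y x∼b with reclose rotated-path (col e) (there e∈)
        ... | es′ , P , ρ = completed P (All.tail (All-resp-↭ ρ (closing ∷ rotated-valid)))
              (↭-trans (prep _ (prep _ (↭-sym (drop-∷ (map⁺ col ρ))))) (rotated-rainbow π)) a∼y x∼b

      choose : ∀ {c′} (p : Edge → Bool) → suc κ ≤ count p fs → κ ≤ count (G c′ (src β)) Ys →
               ∃ λ f → f ∈ fs × p f ≡ true × G c′ (src β) (tgt f) ≡ true
      choose p p≥ q≥ = pigeonhole (ℕ.≤-<-trans (subst (_≤ κ + κ) (sym (length-tgt span)) |Ys|≤2κ)
        (ℕ.+-mono-≤ p≥ (subst (κ ≤_) (count-tgt _ span) q≥)))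

      -- More than `κ` rotated ends and at least `κ` neighbours of `x` cannot be disjoint among at
      -- most `κ + κ` vertices.
      attach : ∀ {α α′} → α ∷ [ α′ ] ↭ c ∷ [ col β ] → suc κ ≤ count (own (tgt β)) fs →
               G α (src β) y ≡ true → Completed
      attach {α} {α′} π high w∼y
        with pigeonhole {as = fs} {p = own (tgt β)} {q = G α′ x ∘ tgt} (ℕ.≤-<-trans (subst (_≤ κ + κ) (sym (length-tgt span)) |Ys|≤2κ)
               (ℕ.+-mono-≤ high (subst (κ ≤_) (count-tgt _ span) (degx α′))))
      ... | f , f∈ , f-own , x∼f with ∈⇒↭ f∈
      ...   | fs′ , fs↭ = completed (rotated-path fs↭ f-own) (rotated-valid fs↭ f-own)
                            (rotated-rainbow fs↭ f-own π) w∼y x∼f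

      detour-bs : ∀ {e α α′} → α ∷ [ α′ ] ↭ c ∷ [ col β ] → suc κ ≤ count (own (tgt β)) fs → e ∈ bs′ →
                  G α (src e) y ≡ true → G α′ x (tgt e) ≡ true → Completed
      detour-bs {e} π high e∈ a∼y x∼b with choose (own (tgt β)) high (deg≥κ (col e) src∈)
      ... | f , f∈ , f-own , closing with ∈⇒↭ f∈
      ...   | fs′ , fs↭ = detour fs↭ f-own π (∈-++⁺ʳ fs′ e∈) closing a∼y x∼b

      -- The rotation must leave `e` in place, so `e` is set aside first. This costs at most one in
      -- each of the two counts but only one in the length, which the bound `κ + 2` compensates.
      detour-fs : ∀ {e α α′} → α ∷ [ α′ ] ↭ c ∷ [ col β ] → suc (suc κ) ≤ count (own (tgt β)) fs → e ∈ fs →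
                  G α (src e) y ≡ true → G α′ x (tgt e) ≡ true → Completed
      detour-fs {e} π high e∈ a∼y x∼b with ∈⇒↭ e∈
      ... | fs₀ , fs↭₀ with pigeonhole {as = fs₀} {p = own (tgt β)} {q = G (col e) (src β) ∘ tgt} enough
        where
        enough : length fs₀ < count (own (tgt β)) fs₀ + count (G (col e) (src β) ∘ tgt) fs₀
        enough = begin
          suc (length fs₀) ≡⟨ sym (↭-length fs↭₀) ⟩
          length fs        ≡⟨ length-tgt span ⟩
          length Ys        ≤⟨ |Ys|≤2κ ⟩
          κ + κ            ≤⟨ ℕ.+-monoʳ-≤ κ (subst (κ ≤_) (trans (count-tgt _ span) (count-↭ fs↭₀))
                                                    (deg≥κ (col e) src∈)) ⟩
          κ + (𝟙 _ + count _ fs₀)  ≤⟨ ℕ.+-monoʳ-≤ κ (ℕ.+-monoˡ-≤ _ (𝟙≤1 (G (col e) (src β) (tgt e)))) ⟩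
          κ + suc (count _ fs₀)    ≡⟨ ℕ.+-suc κ _ ⟩
          suc κ + count _ fs₀      ≤⟨ ℕ.+-monoˡ-≤ _ (drop-𝟙 (own (tgt β) e) (subst (suc (suc κ) ≤_) (count-↭ fs↭₀) high)) ⟩
          count (own (tgt β)) fs₀ + count (G (col e) (src β) ∘ tgt) fs₀ ∎
          where open ℕ.≤-Reasoning
      ...   | f , f∈ , f-own , closing with ∈⇒↭ f∈
      ...     | fs₁ , fs↭₁ = detour (↭-trans fs↭₀ (↭-trans (prep e fs↭₁) (swap e f ↭-refl))) f-own π
                               (here refl) closing a∼y x∼b

    module _ (e₀ : Edge) (e₀∈bs : e₀ ∈ bs) (e₀∼y : G c (src e₀) y ≡ true) (x∼e₀ : G c x (tgt e₀) ≡ true) where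

      private
        -- In-degree in the auxiliary digraph with an arc from `f` to every `b` that is joined to
        -- `src f` in the colour of `f`.
        indegree : Y → ℕ
        indegree b = count (own b) fs

      -- Each `f` sends out at least `κ + 1` arcs, a possible arc to `y` included; the right-hand
      -- side counts them at their heads.
      degree-sum : length fs * suc κ ≤ indegree y + ∑ Ys indegree
      degree-sum = begin
        length fs * suc κ ≡⟨ sym (∑-const fs (suc κ)) ⟩
        ∑ fs (λ _ → suc κ) ≤⟨ ∑-mono (λ f∈ → degX _ (∈-resp-↭ (Spans.srcs↭ span) (∈-map⁺ src f∈))) ⟩
        ∑ fs (λ f → 𝟙 (own y f) + count (G (col f) (src f)) Ys) ≡⟨ ∑-+ fs _ _ ⟩
        indegree y + ∑ fs (λ f → count (G (col f) (src f)) Ys) ≡⟨ cong (indegree y +_) (∑-swap fs Ys _) ⟩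
        indegree y + ∑ Ys indegree ∎
        where open ℕ.≤-Reasoning

      -- Of the `κ + 1` arcs per edge of `fs`, one pays for the arcs into `y` and for the
      -- `c`-neighbours of `x`, by the hypothesis. The other `κ` are spread over `Ys`.
      average : indegree y + count (G c x) Ys ≤ length fs →
                ∑ Ys (λ b → κ + 𝟙 (G c x b)) ≤ ∑ Ys indegree
      average few = ℕ.+-cancelˡ-≤ (indegree y) _ _ (begin
        indegree y + ∑ Ys (λ b → κ + 𝟙 (G c x b)) ≡⟨ cong (indegree y +_) (∑-+ Ys _ _) ⟩
        indegree y + (∑ Ys (λ _ → κ) + count (G c x) Ys) ≡⟨ cong (λ k → indegree y + (k + count (G c x) Ys)) (∑-const Ys κ) ⟩
        indegree y + (length Ys * κ + count (G c x) Ys) ≡⟨ cong (λ k → indegree y + (k * κ + count (G c x) Ys)) (sym (length-tgt span)) ⟩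
        indegree y + (length fs * κ + count (G c x) Ys) ≡⟨ cong (indegree y +_) (ℕ.+-comm (length fs * κ) _) ⟩
        indegree y + (count (G c x) Ys + length fs * κ) ≡⟨ sym (ℕ.+-assoc (indegree y) _ _) ⟩
        indegree y + count (G c x) Ys + length fs * κ   ≤⟨ ℕ.+-monoˡ-≤ _ few ⟩
        length fs + length fs * κ                       ≡⟨ sym (ℕ.*-suc (length fs) κ) ⟩
        length fs * suc κ                               ≤⟨ degree-sum ⟩
        indegree y + ∑ Ys indegree                      ∎)
        where open ℕ.≤-Reasoning

      -- If x is c-adjacent to tgt β, then the edge e of the detour may belong to fs; the extra unit of
      -- indegree allows the end to be rotated by an edge other than e.
      complete-at : ∀ {β bs′} → Walk (inj₁ (src β)) (inj₂ (tgt β)) fs bs′ → bs ↭ β ∷ bs′ →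
                    κ + 𝟙 (G c x (tgt β)) < indegree (tgt β) → Completed
      complete-at {β} {bs′} W bs↭ high with G c (src β) y in c∼y | G (col β) (src β) y in β∼y | G c x (tgt β) in x∼β
      ... | true  | _     | _ = attach W bs↭ ↭-refl (ℕ.≤-<-trans (ℕ.m≤m+n κ _) high) c∼y
      ... | false | true  | _ = attach W bs↭ (swap _ _ ↭-refl) (ℕ.≤-<-trans (ℕ.m≤m+n κ _) high) β∼y
      -- As `β` itself is counted on neither side, passing from `bs` to `bs′` keeps both counts at
      -- least `κ` while the length drops below `κ + κ`.
      ... | false | false | false with pigeonhole {as = bs′} {p = λ e → G (col β) (src e) y} {q = G c x ∘ tgt} enough
        where
        enough : length bs′ < count (λ e → G (col β) (src e) y) bs′ + count (G c x ∘ tgt) bs′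
        enough = begin
          suc (length bs′) ≡⟨ sym (↭-length bs↭) ⟩
          length bs        ≡⟨ length-tgt span-bs ⟩
          length Ys        ≤⟨ |Ys|≤2κ ⟩
          κ + κ            ≤⟨ ℕ.+-mono-≤ (subst (κ ≤_) (trans (count-src _ span-bs) (count-drop bs↭ β∼y)) (degy (col β)))
                                         (subst (κ ≤_) (trans (count-tgt _ span-bs) (count-drop bs↭ x∼β)) (degx c)) ⟩
          count _ bs′ + count _ bs′ ∎
          where open ℕ.≤-Reasoning
      ...   | e , e∈ , a∼y , x∼b = detour-bs W bs↭ (swap _ _ ↭-refl) (ℕ.≤-<-trans (ℕ.m≤m+n κ _) high) e∈ a∼y x∼b
      -- Now `tgt β` is a `c`-neighbour of `x`, so the colours trade roles: `c` goes to `y` and the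
      -- colour of `β` to `x`. The edge found cannot be `β`, since `src β` is not joined to `y` in
      -- `c`.
      complete-at {β} {bs′} W bs↭ high | false | false | true
        with meeting-edge cyc span (λ a → G c a y) (G (col β) x)
               (ℕ.≤-trans |Ys|≤2κ (ℕ.+-mono-≤ (degy c) (degx (col β))))
               (ℕ.<-≤-trans 0<κ (degy c)) (ℕ.<-≤-trans 0<κ (degx (col β)))
      ... | e , inj₁ e∈fs , a∼y , x∼b = detour-fs W bs↭ ↭-refl (subst (_< indegree (tgt β)) (ℕ.+-comm κ 1) high) e∈fs a∼y x∼b
      ... | e , inj₂ e∈bs , a∼y , x∼b with ∈-resp-↭ bs↭ e∈bs
      ...   | here refl   = ⊥-elim (false≢true c∼y a∼y)
      ...   | there e∈bs′ = detour-bs W bs↭ ↭-refl (ℕ.≤-<-trans (ℕ.m≤m+n κ _) high) e∈bs′ a∼y x∼b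

      -- If the in-degree of `tgt e₀` exceeds `κ`, then `attach` works at `e₀`. Otherwise `tgt e₀`,
      -- a `c`-neighbour of `x`, lies strictly below the average, so some other vertex lies strictly
      -- above it.
      complete-bs : (∀ {f} → f ∈ fs → own y f ≡ true → G c x (tgt f) ≡ true → ⊥) → Completed
      complete-bs none with suc κ ≤? indegree (tgt e₀)
      ... | yes high with break cyc e₀∈bs
      ...   | bs′ , W , bs↭ = attach W bs↭ ↭-refl high e₀∼y
      complete-bs none | no low
        with ∑-≤⇒∃ (average few) (∈-resp-↭ (Spans.tgts↭ span-bs) (∈-map⁺ tgt e₀∈bs))
               (subst (λ b → indegree (tgt e₀) < κ + 𝟙 b) (sym x∼e₀) (subst (indegree (tgt e₀) <_) (ℕ.+-comm 1 κ) (ℕ.≰⇒> low)))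
        where
        few : indegree y + count (G c x) Ys ≤ length fs
        few with indegree y + count (G c x) Ys ≤? length fs
        ... | yes le = le
        ... | no ¬le with pigeonhole {as = fs} {p = own y} {q = G c x ∘ tgt}
                            (subst (λ k → length fs < indegree y + k) (count-tgt _ span) (ℕ.≰⇒> ¬le))
        ...   | f , f∈ , f-own , x∼f = ⊥-elim (none f∈ f-own x∼f)
      ...   | b , b∈Ys , high with ∈-map⁻ tgt (∈-resp-↭ (↭-sym (Spans.tgts↭ span-bs)) b∈Ys)
      ...     | β , β∈bs , refl with break cyc β∈bs
      ...       | bs′ , W , bs↭ = complete-at W bs↭ high

  -- An edge of `fs` joined to `y` in its own colour and to `x` in `c` finishes at once. Without
  -- one, the two sets of edges are disjoint, as the averaging requires.
  complete-via-bs : ∀ {fs bs c e} → RainbowCycle fs bs c → e ∈ bs →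
                    G c (src e) y ≡ true → G c x (tgt e) ≡ true → Completed
  complete-via-bs {fs} {c = c} R e∈bs e∼y x∼e
    with search₂ (own R y) (G c x ∘ tgt) fs
  ... | inj₁ (f , f∈fs , f-own , x∼f) = straight (flip-rainbow R f∈fs) f∈fs f-own x∼f
  ... | inj₂ none = complete-bs R _ e∈bs e∼y x∼e none

  -- The start of the averaging is an edge whose ends are joined to `y` and `x`, both in `c`. If it
  -- lies in `fs`, the edge classes are exchanged.
  complete : ∀ {fs bs c} → RainbowCycle fs bs c → Completed
  complete {c = c} R@(rainbowCycle cyc span _ _)
    with meeting-edge cyc span (λ a → G c a y) (G c x) (ℕ.≤-trans |Ys|≤2κ (ℕ.+-mono-≤ (degy c) (degx c)))
           (ℕ.<-≤-trans 0<κ (degy c)) (ℕ.<-≤-trans 0<κ (degx c))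
  ... | e , inj₂ e∈bs , e∼y , x∼e = complete-via-bs R e∈bs e∼y x∼e
  ... | e , inj₁ e∈fs , e∼y , x∼e = complete-via-bs (flip-rainbow R e∈fs) e∈fs e∼y x∼e

  degY≥κ : ∀ c {b} → b ∈ Ys → κ ≤ count (λ a → G c a b) Xs
  degY≥κ c {b} b∈Ys = drop-𝟙 _ (degY c b∈Ys)

  -- An end not joined to its outer vertex has at least `κ + 1` neighbours on the path. With the `κ`
  -- of the other end this exceeds `κ + κ`, so Ore's exchange applies.
  complete-path : ∀ {u v es c d} → Path u v Xs Ys es → All Valid es → c ∷ d ∷ colours es ↭ Cs → Completed
  complete-path {u} {v} {es} {c} {d} P@(path {fs} {bs} W sp es↭) valid rainbow = by-cases _ _ refl refl
    where
    u∈Xs : u ∈ Xs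
    u∈Xs = ∈-resp-↭ (Spans.srcs↭ sp) (∈-resp-↭ (↭-trans (↭-sym (balance-src W)) (++-identityʳ _)) (here refl))

    v∈Ys : v ∈ Ys
    v∈Ys = ∈-resp-↭ (Spans.tgts↭ sp) (∈-resp-↭ (balance-tgt W) (∈-++⁺ʳ (tgts bs) (here refl)))

    via-cycle : κ + κ < count (G c u) Ys + count (λ a → G d a v) Xs → Completed
    via-cycle lt with pigeonhole {as = fs} {p = G c u ∘ tgt} {q = λ f → G d (src f) v}
      (subst₂ (λ m n → length fs < m + n) (count-tgt _ sp) (count-src _ sp)
        (ℕ.≤-<-trans (subst (_≤ κ + κ) (sym (length-tgt sp)) |Ys|≤2κ) lt))
    ... | f , f∈ , u∼f , f∼v with ∈⇒↭ f∈
    ...   | fs′ , fs↭ with cross W fs↭ c d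
    -- The two crossing edges use up `c` and `d`, and the colour of `f` becomes the one that the
    -- cycle misses.
    ...     | crossing cyc span′ es↭′ = complete (rainbowCycle cyc (span′ sp)
                (All-resp-↭ (↭-sym es↭′) (u∼f ∷ f∼v ∷ All.tail (All-resp-↭ σ valid)))
                (↭-trans (prep _ (map⁺ col es↭′)) (↭-trans (to-front (col f) c d _)
                  (↭-trans (prep c (prep d (map⁺ col (↭-sym σ)))) rainbow))))
      where
      σ : es ↭ f ∷ fs′ ++ bs
      σ = ↭-trans (↭-sym es↭) (++⁺ʳ bs fs↭)
      to-front : ∀ {A : Set} (a b c : A) as → a ∷ b ∷ c ∷ as ↭ b ∷ c ∷ a ∷ as
      to-front a b c as = ↭-trans (swap a b ↭-refl) (prep b (swap a c ↭-refl))

    by-cases : ∀ i j → G c u y ≡ i → G d x v ≡ j → Completed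
    by-cases true  true  u∼y x∼v = completed P valid rainbow u∼y x∼v
    by-cases true  false u∼y x∼v = via-cycle (ℕ.+-mono-≤-< (deg≥κ c u∈Xs)
                                     (subst (λ i → suc κ ≤ 𝟙 i + count (λ a → G d a v) Xs) x∼v (degY d v∈Ys)))
    by-cases false j     u∼y x∼v = via-cycle (ℕ.+-mono-<-≤
                                     (subst (λ i → suc κ ≤ 𝟙 i + count (G c u) Ys) u∼y (degX c u∈Xs)) (degY≥κ d v∈Ys))

-- Joining, splitting, closing and opening paths

module Paths (C X Y : Set) where
  open Counting C X Y public

  spans-self : ∀ {fs} → Spans fs (srcs fs) (tgts fs)
  spans-self = spans ↭-refl ↭-refl

  spans-resp : ∀ {fs fs′ xs xs′ ys ys′} → fs ↭ fs′ → xs ↭ xs′ → ys ↭ ys′ → Spans fs xs ys → Spans fs′ xs′ ys′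
  spans-resp ρ σ τ (spans σ′ τ′) = spans (↭-trans (map⁺ src (↭-sym ρ)) (↭-trans σ′ σ))
                                         (↭-trans (map⁺ tgt (↭-sym ρ)) (↭-trans τ′ τ))

  spans-++ : ∀ {fs fs′ xs xs′ ys ys′} → Spans fs xs ys → Spans fs′ xs′ ys′ → Spans (fs ++ fs′) (xs ++ xs′) (ys ++ ys′)
  spans-++ {fs} {fs′} (spans σ τ) (spans σ′ τ′) =
    spans (↭-trans (↭-reflexive (map-++ src fs fs′)) (++⁺ σ σ′)) (↭-trans (↭-reflexive (map-++ tgt fs fs′)) (++⁺ τ τ′))

  path-resp : ∀ {a b xs xs′ ys ys′ es es′} → xs ↭ xs′ → ys ↭ ys′ → es ↭ es′ → Path a b xs ys es → Path a b xs′ ys′ es′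
  path-resp σ τ ρ (path W sp es↭) = path W (spans-resp ↭-refl σ τ sp) (↭-trans es↭ ρ)

  module _ {a b fs bs xs ys} (W : Walk (inj₁ a) (inj₂ b) fs bs) (sp : Spans fs xs ys) where

    xs↭src∷ : xs ↭ a ∷ srcs bs
    xs↭src∷ = ↭-trans (↭-sym (Spans.srcs↭ sp)) (↭-trans (↭-sym (++-identityʳ _)) (balance-src W))

    ys↭tgt∷ : ys ↭ b ∷ tgts bs
    ys↭tgt∷ = ↭-trans (↭-sym (Spans.tgts↭ sp)) (↭-trans (↭-sym (balance-tgt W)) (↭-sym (∷↭∷ʳ b (tgts bs))))

    count-inner-src : (p : X → Bool) → p a ≡ false → count p xs ≡ count (p ∘ src) bs
    count-inner-src p ¬pa = trans (count-drop xs↭src∷ ¬pa) (∑-map src bs _)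

    count-inner-tgt : (q : Y → Bool) → q b ≡ false → count q ys ≡ count (q ∘ tgt) bs
    count-inner-tgt q ¬qb = trans (count-drop ys↭tgt∷ ¬qb) (∑-map tgt bs _)

    length-inner : length ys ≡ suc (length bs)
    length-inner = trans (↭-length ys↭tgt∷) (cong suc (length-map tgt bs))

  src∈xs : ∀ {a b xs ys es} → Path a b xs ys es → a ∈ xs
  src∈xs (path W sp _) = ∈-resp-↭ (↭-sym (xs↭src∷ W sp)) (here refl)

  tgt∈ys : ∀ {a b xs ys es} → Path a b xs ys es → b ∈ ys
  tgt∈ys (path W sp _) = ∈-resp-↭ (↭-sym (ys↭tgt∷ W sp)) (here refl)

  edge-src∈ : ∀ {a b xs ys es e} → Path a b xs ys es → e ∈ es → src e ∈ xs
  edge-src∈ (path {fs} W sp es↭) e∈ with ∈-++⁻ fs (∈-resp-↭ (↭-sym es↭) e∈)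
  ... | inj₁ e∈fs = ∈-resp-↭ (Spans.srcs↭ sp) (∈-map⁺ src e∈fs)
  ... | inj₂ e∈bs = ∈-resp-↭ (↭-sym (xs↭src∷ W sp)) (there (∈-map⁺ src e∈bs))

  edge-tgt∈ : ∀ {a b xs ys es e} → Path a b xs ys es → e ∈ es → tgt e ∈ ys
  edge-tgt∈ (path {fs} W sp es↭) e∈ with ∈-++⁻ fs (∈-resp-↭ (↭-sym es↭) e∈)
  ... | inj₁ e∈fs = ∈-resp-↭ (Spans.tgts↭ sp) (∈-map⁺ tgt e∈fs)
  ... | inj₂ e∈bs = ∈-resp-↭ (↭-sym (ys↭tgt∷ W sp)) (there (∈-map⁺ tgt e∈bs))

  module _ {A : Set} where
    open CommutativeMonoidSolver (++-commutativeMonoid {A = A})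

    join↭ : (g : A) (f b f′ b′ : List A) → (f ++ f′) ++ (b ++ g ∷ b′) ↭ g ∷ (f ++ b) ++ (f′ ++ b′)
    join↭ g = solve 5 (λ g f b f′ b′ → (f ⊕ f′) ⊕ (b ⊕ g ⊕ b′) ⊜ g ⊕ ((f ⊕ b) ⊕ (f′ ⊕ b′))) ↭-refl [ g ]

    split↭ : (e : A) (f b f′ b′ : List A) → (f ++ f′) ++ (e ∷ b ++ b′) ↭ e ∷ (f ++ b) ++ (f′ ++ b′)
    split↭ e = solve 5 (λ e f b f′ b′ → (f ⊕ f′) ⊕ (e ⊕ b ⊕ b′) ⊜ e ⊕ ((f ⊕ b) ⊕ (f′ ⊕ b′))) ↭-refl [ e ]

  join : ∀ {a b a′ b′ xs ys es xs′ ys′ es′} → Path a b xs ys es → ∀ c → Path a′ b′ xs′ ys′ es′ →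
         Path a b′ (xs ++ xs′) (ys ++ ys′) (edge c a′ b ∷ es ++ es′)
  join {b = b} {a′} (path {fs} {bs} W sp es↭) c (path {fs′} {bs′} W′ sp′ es↭′) =
    path (W ⊙ bwd (edge c a′ b) W′) (spans-++ sp sp′)
         (↭-trans (join↭ (edge c a′ b) fs bs fs′ bs′) (prep _ (++⁺ es↭ es↭′)))

  record PathSplit (a : X) (b : Y) (e : Edge) (xs : List X) (ys : List Y) (es : List Edge) : Set where
    constructor pathSplit
    field
      {xs₁ xs₂} : List X
      {ys₁ ys₂} : List Y
      {es₁ es₂} : List Edge
      before : Path a (tgt e) xs₁ ys₁ es₁
      after  : Path (src e) b xs₂ ys₂ es₂
      xs↭ : xs ↭ xs₁ ++ xs₂
      ys↭ : ys ↭ ys₁ ++ ys₂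
      es↭ : es ↭ e ∷ es₁ ++ es₂

  -- Cutting at a backward edge leaves two pieces that again run from `X` to `Y`. At a forward edge
  -- the pieces would be unbalanced.
  split-bwd : ∀ {a b e fs bs xs ys} → Walk (inj₁ a) (inj₂ b) fs bs → Spans fs xs ys → e ∈ bs →
              PathSplit a b e xs ys (fs ++ bs)
  split-bwd {e = e} W (spans σ τ) e∈ with split-at (rev W) e∈
  ... | split {b₂} {f₂} {b₁} {f₁} B A ρ υ =
    pathSplit (path (rev A) spans-self ↭-refl) (path (rev B) spans-self ↭-refl)
      (↭-trans (↭-sym σ) (↭-trans (map⁺ src υ′) (↭-reflexive (map-++ src f₁ f₂))))
      (↭-trans (↭-sym τ) (↭-trans (map⁺ tgt υ′) (↭-reflexive (map-++ tgt f₁ f₂))))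
      (↭-trans (++⁺ υ′ (↭-trans ρ (prep e (++-rotate b₂ b₁)))) (split↭ e f₁ b₁ f₂ b₂))
    where υ′ = ↭-trans υ (++-rotate f₂ f₁)

  record Ring (xs : List X) (ys : List Y) (es : List Edge) : Set where
    constructor ring
    field
      {fs bs} : List Edge
      cyc  : Cycle fs bs
      span : Spans fs xs ys
      es↭  : fs ++ bs ↭ es

  close-ring : ∀ {a b xs ys es} → Path a b xs ys es → ∀ c → Ring xs ys (edge c a b ∷ es)
  close-ring (path {fs} {bs} W sp es↭) c = ring (close W c) sp (↭-trans (shift _ fs bs) (prep _ es↭))

  open-ring-bs : ∀ {fs bs xs ys e es} → Cycle fs bs → Spans fs xs ys → fs ++ bs ↭ es → e ∈ bs →
                 ∃ λ es′ → Path (src e) (tgt e) xs ys es′ × es ↭ e ∷ es′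
  open-ring-bs {fs} {e = e} cyc sp es↭ e∈ with break cyc e∈
  ... | bs′ , W , τ = _ , path W sp ↭-refl , ↭-trans (↭-sym es↭) (↭-trans (++⁺ˡ fs τ) (shift e fs bs′))

  open-ring : ∀ {xs ys es e} → Ring xs ys es → e ∈ es → ∃ λ es′ → Path (src e) (tgt e) xs ys es′ × es ↭ e ∷ es′
  open-ring (ring {fs} {bs} cyc sp es↭) e∈ with ∈-++⁻ fs (∈-resp-↭ (↭-sym es↭) e∈)
  ... | inj₂ e∈bs = open-ring-bs cyc sp es↭ e∈bs
  ... | inj₁ e∈fs = open-ring-bs (flip-cycle cyc e∈fs) (spans-other cyc sp) (↭-trans (++-rotate bs fs) es↭) e∈fs

  -- The edges of `bs` cover every vertex of the cycle, so there is one at `a` to open it.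
  open-from : ∀ {xs ys es a} → Ring xs ys es → a ∈ xs → ∃ λ e → ∃ λ es′ → Path a (tgt e) xs ys es′ × es ↭ e ∷ es′
  open-from (ring cyc sp es↭) a∈ with ∈-map⁻ src (∈-resp-↭ (↭-sym (Spans.srcs↭ (spans-other cyc sp))) a∈)
  ... | e , e∈bs , refl = e , open-ring-bs cyc sp es↭ e∈bs

  open-to : ∀ {xs ys es b} → Ring xs ys es → b ∈ ys → ∃ λ e → ∃ λ es′ → Path (src e) b xs ys es′ × es ↭ e ∷ es′
  open-to (ring cyc sp es↭) b∈ with ∈-map⁻ tgt (∈-resp-↭ (↭-sym (Spans.tgts↭ (spans-other cyc sp))) b∈)
  ... | e , e∈bs , refl = e , open-ring-bs cyc sp es↭ e∈bs

  length-ring : ∀ {xs ys es} → Ring xs ys es → length xs ≡ length ys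
  length-ring (ring _ sp _) = trans (sym (length-src sp)) (length-tgt sp)

-- Joining two segments

module Segments
  (C X Y : Set) (H : C → X → Y → Bool)
  (Xs : List X) (Ys : List Y) (Cs : List C) (κ : ℕ) (|Ys|≤2κ : length Ys ≤ κ + κ)
  (degX : ∀ c {a} → a ∈ Xs → κ ≤ count (H c a) Ys)
  (degY : ∀ c {b} → b ∈ Ys → κ ≤ count (λ a → H c a b) Xs)
  where
  open Paths C X Y

  Valid : Edge → Set
  Valid e = H (col e) (src e) (tgt e) ≡ true

  record HamPath : Set where
    constructor hamPath
    field
      {a}  : X
      {b}  : Y
      {es} : List Edge
      {α β} : C
      inner   : Path a b Xs Ys es
      valid   : All Valid es
      rainbow : α ∷ β ∷ colours es ↭ Cs

  NoEdges : C → List X → List Y → Set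
  NoEdges c xs ys = ∀ {a b} → a ∈ xs → b ∈ ys → H c a b ≡ false

  record Separated : Set where
    constructor separated
    field
      {xs₁ xs₂} : List X
      {ys₁ ys₂} : List Y
      Xs↭ : Xs ↭ xs₁ ++ xs₂
      Ys↭ : Ys ↭ ys₁ ++ ys₂
      |xs₁| : length xs₁ ≡ κ
      |xs₂| : length xs₂ ≡ κ
      |ys₁| : length ys₁ ≡ κ
      |ys₂| : length ys₂ ≡ κ
      apart : ∀ {c} → c ∈ Cs → NoEdges c xs₁ ys₂ × NoEdges c xs₂ ys₁

  -- `ms` lists the free colours: three for two paths, two for a ring and a path, one for two rings.
  record Rainbow (ms : List C) (es : List Edge) : Set where
    constructor rainbow
    field
      valid    : All Valid es
      colours↭ : ms ++ colours es ↭ Cs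

  rainbow-resp : ∀ {ms ms′ es es′} → ms ↭ ms′ → es ↭ es′ → Rainbow ms es → Rainbow ms′ es′
  rainbow-resp π σ (rainbow V ρ) = rainbow (All-resp-↭ σ V)
    (↭-trans (++⁺ (↭-sym π) (map⁺ col (↭-sym σ))) ρ)

  use : ∀ {c ms a b es} → H c a b ≡ true → Rainbow (c ∷ ms) es → Rainbow ms (edge c a b ∷ es)
  use {c} {ms} {es = es} h (rainbow V ρ) = rainbow (h ∷ V) (↭-trans (shift c ms (colours es)) ρ)

  discard : ∀ {ms e es} → Rainbow ms (e ∷ es) → Rainbow (col e ∷ ms) es
  discard {ms} {e} {es} (rainbow (_ ∷ V) ρ) = rainbow V (↭-trans (↭-sym (shift (col e) ms (colours es))) ρ)

  toHamPath : ∀ {a b xs ys es α β} → Xs ↭ xs → Ys ↭ ys → Path a b xs ys es → Rainbow (α ∷ β ∷ []) es → HamPath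
  toHamPath σ τ P (rainbow V ρ) = hamPath (path-resp (↭-sym σ) (↭-sym τ) ↭-refl P) V ρ

  module _ {A : Set} where
    open CommutativeMonoidSolver (++-commutativeMonoid {A = A})

    cons-mid↭ : (g h : A) (as bs : List A) → g ∷ h ∷ as ++ bs ↭ as ++ g ∷ h ∷ bs
    cons-mid↭ g h = solve 4 (λ g h a b → g ⊕ h ⊕ a ⊕ b ⊜ a ⊕ g ⊕ h ⊕ b) ↭-refl [ g ] [ h ]

    insert↭ : (g h : A) (as bs cs : List A) → g ∷ h ∷ bs ++ (as ++ cs) ↭ h ∷ (g ∷ as ++ bs) ++ cs
    insert↭ g h = solve 5 (λ g h a b c → g ⊕ h ⊕ b ⊕ (a ⊕ c) ⊜ h ⊕ (g ⊕ a ⊕ b) ⊕ c) ↭-refl [ g ] [ h ]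

    insert-mid↭ : (as bs cs : List A) → bs ++ (as ++ cs) ↭ (as ++ bs) ++ cs
    insert-mid↭ = solve 3 (λ a b c → b ⊕ (a ⊕ c) ⊜ (a ⊕ b) ⊕ c) ↭-refl

  module TwoSegments {xs₁ xs₂ ys₁ ys₂} (Xs↭ : Xs ↭ xs₁ ++ xs₂) (Ys↭ : Ys ↭ ys₁ ++ ys₂) where

    Xs↭′ : Xs ↭ xs₂ ++ xs₁
    Xs↭′ = ↭-trans Xs↭ (++-rotate xs₁ xs₂)

    Ys↭′ : Ys ↭ ys₂ ++ ys₁
    Ys↭′ = ↭-trans Ys↭ (++-rotate ys₁ ys₂)

    -- Both rings are opened at the ends of the connecting edge; the two edges removed provide the
    -- two colours left free.
    bridge : ∀ {es₁ es₂ ε a b} → Ring xs₁ ys₁ es₁ → Ring xs₂ ys₂ es₂ → Rainbow (ε ∷ []) (es₁ ++ es₂) →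
             a ∈ xs₁ → b ∈ ys₂ → H ε a b ≡ true → HamPath
    bridge {es₁} {es₂} {ε} R₁ R₂ V a∈ b∈ h with open-from R₁ a∈ | open-to R₂ b∈
    ... | e₁ , es₁′ , P₁ , σ₁ | e₂ , es₂′ , P₂ , σ₂ =
      toHamPath Xs↭′ Ys↭′ (join P₂ ε P₁)
        (rainbow-resp ↭-refl (prep _ (++-rotate es₁′ es₂′))
          (use h (rainbow-resp swap₃ ↭-refl (discard {e = e₂} (discard {e = e₁}
            (rainbow-resp ↭-refl (↭-trans (++⁺ σ₁ σ₂) (prep e₁ (shift e₂ es₁′ es₂′))) V))))))
      where
      swap₃ : col e₂ ∷ col e₁ ∷ ε ∷ [] ↭ ε ∷ col e₂ ∷ col e₁ ∷ []
      swap₃ = shift ε (col e₂ ∷ col e₁ ∷ []) []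

    unbridged : ∀ {es₁ es₂ ε} → Ring xs₁ ys₁ es₁ → Ring xs₂ ys₂ es₂ → Rainbow (ε ∷ []) (es₁ ++ es₂) →
                HamPath ⊎ NoEdges ε xs₁ ys₂
    unbridged {ε = ε} R₁ R₂ V with search (λ (a , b) → H ε a b) (cartesianProduct xs₁ ys₂)
    ... | inj₂ none = inj₂ λ a∈ b∈ → none (∈-cartesianProduct⁺ a∈ b∈)
    ... | inj₁ ((a , b) , ab∈ , h) with ∈-cartesianProduct⁻ xs₁ ys₂ ab∈
    ...   | a∈ , b∈ = inj₁ (bridge R₁ R₂ V a∈ b∈ h)

    large : ∀ {ε a} → NoEdges ε xs₁ ys₂ → a ∈ xs₁ → κ ≤ count (H ε a) ys₁
    large {ε} apart a∈ = subst (κ ≤_) (count-only Ys↭ (apart a∈)) (degX ε (∈-resp-↭ (↭-sym Xs↭) (∈-++⁺ˡ a∈)))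

    |ys₁|+|ys₂| : length ys₁ + length ys₂ ≤ κ + κ
    |ys₁|+|ys₂| = subst (_≤ κ + κ) (trans (↭-length Ys↭) (length-++ ys₁)) |Ys|≤2κ

  module _ {xs₁ xs₂ ys₁ ys₂} (Xs↭ : Xs ↭ xs₁ ++ xs₂) (Ys↭ : Ys ↭ ys₁ ++ ys₂) where
    private
      module S = TwoSegments {xs₁} {xs₂} {ys₁} {ys₂} Xs↭ Ys↭
      module S′ = TwoSegments {xs₂} {xs₁} {ys₂} {ys₁} S.Xs↭′ S.Ys↭′

    both-unbridged : ∀ {es₁ es₂ ε} → Ring xs₁ ys₁ es₁ → Ring xs₂ ys₂ es₂ → Rainbow (ε ∷ []) (es₁ ++ es₂) →
                     HamPath ⊎ (NoEdges ε xs₁ ys₂ × NoEdges ε xs₂ ys₁)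
    both-unbridged {es₁} {es₂} R₁ R₂ V
      with S.unbridged R₁ R₂ V | S′.unbridged R₂ R₁ (rainbow-resp ↭-refl (++-rotate es₁ es₂) V)
    ... | inj₁ P | _      = inj₁ P
    ... | inj₂ _ | inj₁ P = inj₁ P
    ... | inj₂ n | inj₂ m = inj₂ (n , m)

    -- If no edge of the free colour `ε` connects the rings, the degrees force halves of size `κ`
    -- that are complete in `ε`. Any ring edge can then be recoloured with `ε`, which frees its old
    -- colour, and the rings must be unconnected in that colour as well.
    two-rings : ∀ {es₁ es₂ ε a₁ a₂} → Ring xs₁ ys₁ es₁ → Ring xs₂ ys₂ es₂ → Rainbow (ε ∷ []) (es₁ ++ es₂) →
                a₁ ∈ xs₁ → a₂ ∈ xs₂ → HamPath ⊎ Separated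
    two-rings {es₁} {es₂} {ε} R₁ R₂ V@(rainbow _ ρ) a₁∈ a₂∈ with both-unbridged R₁ R₂ V
    ... | inj₁ P = inj₁ P
    ... | inj₂ (apart₁ , apart₂) = conclude (all-or-first Cs each)
      where
      κ≤|ys₁| : κ ≤ length ys₁
      κ≤|ys₁| = ℕ.≤-trans (S.large apart₁ a₁∈) (count≤length _ ys₁)

      κ≤|ys₂| : κ ≤ length ys₂
      κ≤|ys₂| = ℕ.≤-trans (S′.large apart₂ a₂∈) (count≤length _ ys₂)

      |ys₁|≤κ : length ys₁ ≤ κ
      |ys₁|≤κ = ℕ.+-cancelʳ-≤ κ _ _ (ℕ.≤-trans (ℕ.+-monoʳ-≤ (length ys₁) κ≤|ys₂|) S.|ys₁|+|ys₂|)

      |ys₂|≤κ : length ys₂ ≤ κ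
      |ys₂|≤κ = ℕ.+-cancelˡ-≤ κ _ _ (ℕ.≤-trans (ℕ.+-monoˡ-≤ (length ys₂) κ≤|ys₁|) S.|ys₁|+|ys₂|)

      |ys₁|≡κ = ℕ.≤-antisym |ys₁|≤κ κ≤|ys₁|
      |ys₂|≡κ = ℕ.≤-antisym |ys₂|≤κ κ≤|ys₂|

      conclude : HamPath ⊎ (∀ {c} → c ∈ Cs → NoEdges c xs₁ ys₂ × NoEdges c xs₂ ys₁) → HamPath ⊎ Separated
      conclude (inj₁ P)     = inj₁ P
      conclude (inj₂ apart) = inj₂ (separated Xs↭ Ys↭ (trans (length-ring R₁) |ys₁|≡κ) (trans (length-ring R₂) |ys₂|≡κ)
                                              |ys₁|≡κ |ys₂|≡κ apart)

      each : ∀ {c} → c ∈ Cs → HamPath ⊎ (NoEdges c xs₁ ys₂ × NoEdges c xs₂ ys₁)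
      each c∈ with ∈-resp-↭ (↭-sym ρ) c∈
      ... | here refl = inj₂ (apart₁ , apart₂)
      ... | there c∈ with ∈-map⁻ col c∈
      ...   | e , e∈ , refl with ∈-++⁻ es₁ e∈
      ...     | inj₁ e∈₁ with open-ring R₁ e∈₁
      ...       | es₁′ , P , σ = both-unbridged (close-ring P ε) R₂
                    (use (count-all (ℕ.≤-trans |ys₁|≤κ (S.large apart₁ (src∈xs P))) (tgt∈ys P))
                      (rainbow-resp (swap _ _ ↭-refl) ↭-refl (discard (rainbow-resp ↭-refl (++⁺ʳ es₂ σ) V))))
      each c∈ | there _ | e , e∈ , refl
              | inj₂ e∈₂ with open-ring R₂ e∈₂
      ...       | es₂′ , P , σ = both-unbridged R₁ (close-ring P ε)
                    (rainbow-resp ↭-refl (↭-sym (shift _ es₁ es₂′))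
                      (use (count-all (ℕ.≤-trans |ys₂|≤κ (S′.large apart₂ (src∈xs P))) (tgt∈ys P))
                        (rainbow-resp (swap _ _ ↭-refl) ↭-refl (discard
                          (rainbow-resp ↭-refl (↭-trans (++⁺ˡ es₁ σ) (shift e es₁ es₂′)) V)))))

    -- An edge from an end of the path to the ring yields a Hamiltonian path. Otherwise all
    -- neighbours of both ends lie on the path, which has fewer than `κ + κ` vertices in `Y`, and
    -- Ore's exchange closes it to a second ring.
    ring-and-path : ∀ {es₁ es₂ p v γ δ a₁} → Ring xs₁ ys₁ es₁ → Path p v xs₂ ys₂ es₂ →
                    Rainbow (γ ∷ δ ∷ []) (es₁ ++ es₂) → a₁ ∈ xs₁ → HamPath ⊎ Separated
    ring-and-path {es₁} {es₂} {p} {v} {γ} {δ} {a₁} R P@(path {fs} {bs} W sp es↭) V a₁∈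
      with search (λ a → H γ a v) xs₁ | search (H δ p) ys₁
    ... | inj₁ (a , a∈ , h) | _ with open-from R a∈
    ...   | e , es₁′ , Q , σ = inj₁ (toHamPath S.Xs↭′ S.Ys↭′ (join P γ Q)
              (use h (rainbow-resp (swap _ _ ↭-refl) (++-rotate es₁′ es₂)
                (discard (rainbow-resp ↭-refl (++⁺ʳ es₂ σ) V)))))
    ring-and-path {es₁} {es₂} {p} {v} {γ} {δ} R P V a₁∈ | inj₂ _ | inj₁ (b , b∈ , h) with open-to R b∈
    ...   | e , es₁′ , Q , σ = inj₁ (toHamPath Xs↭ Ys↭ (join Q δ P)
              (use h (rainbow-resp (shift δ (col e ∷ γ ∷ []) []) ↭-refl
                (discard (rainbow-resp ↭-refl (++⁺ʳ es₂ σ) V)))))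
    ring-and-path {es₁} {es₂} {p} {v} {γ} {δ} {a₁} R P@(path {fs} {bs} W sp es↭) V a₁∈ | inj₂ noX | inj₂ noY
      with pigeonhole {as = fs} {p = H δ p ∘ tgt} {q = λ f → H γ (src f) v} enough
      where
      0<|ys₁| : 0 < length ys₁
      0<|ys₁| = subst (0 <_) (length-ring R) (nonempty a₁∈)
        where
        nonempty : ∀ {A : Set} {a : A} {as} → a ∈ as → 0 < length as
        nonempty (here _)  = s≤s z≤n
        nonempty (there _) = s≤s z≤n

      enough : length fs < count (H δ p ∘ tgt) fs + count (λ f → H γ (src f) v) fs
      enough = begin-strict
        length fs               ≡⟨ length-tgt sp ⟩
        length ys₂              <⟨ ℕ.+-monoˡ-≤ (length ys₂) 0<|ys₁| ⟩
        length ys₁ + length ys₂ ≤⟨ S.|ys₁|+|ys₂| ⟩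
        κ + κ ≤⟨ ℕ.+-mono-≤
                   (subst (κ ≤_) (trans (count-only S.Ys↭′ noY) (count-tgt _ sp)) (degX δ (∈-resp-↭ (↭-sym Xs↭) (∈-++⁺ʳ xs₁ (src∈xs P)))))
                   (subst (κ ≤_) (trans (count-only S.Xs↭′ noX) (count-src _ sp)) (degY γ (∈-resp-↭ (↭-sym Ys↭) (∈-++⁺ʳ ys₁ (tgt∈ys P))))) ⟩
        count (H δ p ∘ tgt) fs + count (λ f → H γ (src f) v) fs ∎
        where open ℕ.≤-Reasoning
    ... | f , f∈ , p∼f , f∼v with ∈⇒↭ f∈
    ...   | fs′ , fs↭ with cross W fs↭ δ γ
    ...     | crossing cyc span′ es↭′ = two-rings R (ring cyc (span′ sp) es↭′)
                (rainbow-resp ↭-refl (cons-mid↭ _ _ es₁ (fs′ ++ bs))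
                  (use p∼f (use f∼v (rainbow-resp (shift₂ (col f) γ δ) ↭-refl
                    (discard (rainbow-resp ↭-refl (↭-trans (++⁺ˡ es₁ (↭-trans (↭-sym es↭) (++⁺ʳ bs fs↭))) (shift f es₁ (fs′ ++ bs))) V))))))
                a₁∈ (src∈xs P)
      where
      shift₂ : ∀ {A : Set} (a b c : A) → a ∷ b ∷ c ∷ [] ↭ b ∷ c ∷ a ∷ []
      shift₂ a b c = ↭-sym (shift a (b ∷ c ∷ []) [])

    -- Unless an edge `u`-`v` or `p`-`q` joins the paths directly, the neighbours of `u` and `q` are
    -- counted along `fs₁` and `bs₂`, together one edge fewer than `length Ys`. A coincidence in
    -- `fs₁` closes the first path to a ring; one in `bs₂` lets the first path be inserted into the
    -- second.
    two-paths : ∀ {es₁ es₂ u q p v α β γ} → Path u q xs₁ ys₁ es₁ → Path p v xs₂ ys₂ es₂ →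
                Rainbow (α ∷ β ∷ γ ∷ []) (es₁ ++ es₂) → HamPath ⊎ Separated
    two-paths {es₁} {es₂} {u} {q} {p} {v} {α} {β} {γ} P₁@(path {fs₁} {bs₁} W₁ sp₁ es↭₁) P₂@(path {fs₂} {bs₂} W₂ sp₂ es↭₂) V
      = by-cases _ _ refl refl
      where
      insert : ∀ {e} → e ∈ bs₂ → H α u (tgt e) ≡ true → H β (src e) q ≡ true → HamPath
      insert {e} e∈ u∼e e∼q with split-bwd {e = e} W₂ sp₂ e∈
      ... | pathSplit {x₁} {x₂} {y₁} {y₂} {e₁} {e₂} B A xs↭ ys↭ es↭ =
        toHamPath (↭-trans Xs↭ (↭-trans (++⁺ˡ xs₁ xs↭) (insert-mid↭ x₁ xs₁ x₂)))
                  (↭-trans Ys↭ (↭-trans (++⁺ˡ ys₁ ys↭) (insert-mid↭ y₁ ys₁ y₂)))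
                  (join (join B α P₁) β A)
                  (rainbow-resp ↭-refl (insert↭ _ _ e₁ es₁ e₂)
                    (use u∼e (use e∼q (rainbow-resp (swap₃ (col e) α β γ) ↭-refl
                      (discard (rainbow-resp ↭-refl (↭-trans (++⁺ˡ es₁ (↭-trans (↭-sym es↭₂) es↭)) (shift e es₁ (e₁ ++ e₂))) V))))))
        where
        swap₃ : ∀ {A : Set} (a b c d : A) → a ∷ b ∷ c ∷ d ∷ [] ↭ c ∷ b ∷ a ∷ d ∷ []
        swap₃ a b c d = ↭-trans (prep a (swap b c ↭-refl)) (↭-trans (swap a c ↭-refl) (prep c (swap a b ↭-refl)))

      close-first : ∀ {f} → f ∈ fs₁ → H α u (tgt f) ≡ true → H β (src f) q ≡ true → HamPath ⊎ Separated
      close-first {f} f∈ u∼f f∼q with ∈⇒↭ f∈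
      ... | fs′ , fs↭ with cross W₁ fs↭ α β
      ...   | crossing cyc span′ es↭′ = ring-and-path (ring cyc (span′ sp₁) es↭′) P₂
                (use u∼f (use f∼q (rainbow-resp (cycle₄ (col f) α β γ) ↭-refl
                  (discard (rainbow-resp ↭-refl (++⁺ʳ es₂ (↭-trans (↭-sym es↭₁) (++⁺ʳ bs₁ fs↭))) V))))) (src∈xs P₁)
        where
        cycle₄ : ∀ {A : Set} (a b c d : A) → a ∷ b ∷ c ∷ d ∷ [] ↭ c ∷ b ∷ d ∷ a ∷ []
        cycle₄ a b c d = ↭-trans (↭-sym (shift a (b ∷ c ∷ d ∷ []) [])) (swap b c ↭-refl)

      by-cases : ∀ i j → H α u v ≡ i → H β p q ≡ j → HamPath ⊎ Separated
      by-cases true j u∼v _ = inj₁ (toHamPath S.Xs↭′ S.Ys↭′ (join P₂ α P₁)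
        (use u∼v (rainbow-resp ↭-refl (++-rotate es₁ es₂) V)))
      by-cases false true _ p∼q = inj₁ (toHamPath Xs↭ Ys↭ (join P₁ β P₂)
        (use p∼q (rainbow-resp (swap _ _ ↭-refl) ↭-refl V)))
      by-cases false false u≁v p≁q
        with length fs₁ <? count (H α u ∘ tgt) fs₁ + count (λ f → H β (src f) q) fs₁
      ... | yes lt with pigeonhole {as = fs₁} lt
      ...   | f , f∈ , u∼f , f∼q = close-first f∈ u∼f f∼q
      by-cases false false u≁v p≁q | no ¬lt
        with pigeonhole {as = bs₂} {p = H α u ∘ tgt} {q = λ e → H β (src e) q} (ℕ.+-cancelˡ-< (length fs₁) _ _ enough)
        where
        enough : length fs₁ + length bs₂ < length fs₁ + (count (H α u ∘ tgt) bs₂ + count (λ e → H β (src e) q) bs₂)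
        enough = begin-strict
          length fs₁ + length bs₂ <⟨ ℕ.+-monoʳ-< (length fs₁) (ℕ.n<1+n _) ⟩
          length fs₁ + suc (length bs₂) ≡⟨ cong₂ _+_ (length-tgt sp₁) (sym (length-inner W₂ sp₂)) ⟩
          length ys₁ + length ys₂ ≤⟨ S.|ys₁|+|ys₂| ⟩
          κ + κ ≤⟨ ℕ.+-mono-≤ degu degq ⟩
          (count (H α u ∘ tgt) fs₁ + count (H α u ∘ tgt) bs₂) + (count (λ f → H β (src f) q) fs₁ + count (λ e → H β (src e) q) bs₂)
            ≡⟨ +-interchange (count (H α u ∘ tgt) fs₁) _ _ _ ⟩
          (count (H α u ∘ tgt) fs₁ + count (λ f → H β (src f) q) fs₁) + (count (H α u ∘ tgt) bs₂ + count (λ e → H β (src e) q) bs₂)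
            ≤⟨ ℕ.+-monoˡ-≤ _ (ℕ.≮⇒≥ ¬lt) ⟩
          length fs₁ + (count (H α u ∘ tgt) bs₂ + count (λ e → H β (src e) q) bs₂) ∎
          where
          open ℕ.≤-Reasoning
          degu : κ ≤ count (H α u ∘ tgt) fs₁ + count (H α u ∘ tgt) bs₂
          degu = subst (κ ≤_) (trans (count-↭ Ys↭) (trans (count-++ _ ys₁ ys₂)
                   (cong₂ _+_ (count-tgt _ sp₁) (count-inner-tgt W₂ sp₂ _ u≁v)))) (degX α (∈-resp-↭ (↭-sym Xs↭) (∈-++⁺ˡ (src∈xs P₁))))
          degq : κ ≤ count (λ f → H β (src f) q) fs₁ + count (λ e → H β (src e) q) bs₂
          degq = subst (κ ≤_) (trans (count-↭ Xs↭) (trans (count-++ _ xs₁ xs₂)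
                   (cong₂ _+_ (count-src _ sp₁) (count-inner-src W₂ sp₂ _ p≁q)))) (degY β (∈-resp-↭ (↭-sym Ys↭) (∈-++⁺ˡ (tgt∈ys P₁))))
      ... | e , e∈ , u∼e , e∼q = inj₁ (insert e∈ u∼e e∼q)

  module _ {A : Set} where
    open CommutativeMonoidSolver (++-commutativeMonoid {A = A})

    vertices↭ : (a a′ : A) (m f f′ : List A) → a ∷ a′ ∷ m ++ (f ++ f′) ↭ (f ++ a ∷ f′) ++ (a′ ∷ m)
    vertices↭ a a′ = solve 5 (λ a a′ m f f′ → a ⊕ a′ ⊕ m ⊕ (f ⊕ f′) ⊜ (f ⊕ a ⊕ f′) ⊕ (a′ ⊕ m)) ↭-refl [ a ] [ a′ ]

    edges↭ : (g : A) (m f f′ n b b′ : List A) →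
             g ∷ (m ++ (f ++ f′)) ++ (n ++ (b ++ b′)) ↭ ((f ++ g ∷ f′) ++ (b ++ b′)) ++ (n ++ m)
    edges↭ g = solve 7 (λ g m f f′ n b b′ → g ⊕ (m ⊕ (f ⊕ f′)) ⊕ (n ⊕ (b ⊕ b′)) ⊜
                                            ((f ⊕ g ⊕ f′) ⊕ (b ⊕ b′)) ⊕ (n ⊕ m)) ↭-refl [ g ]

    pull-late : (e : A) (f m f′ : List A) → f ++ (e ∷ m ++ f′) ↭ e ∷ m ++ (f ++ f′)
    pull-late e = solve 4 (λ e f m f′ → f ⊕ (e ⊕ m ⊕ f′) ⊜ e ⊕ m ⊕ (f ⊕ f′)) ↭-refl [ e ]

    pull-early : (e : A) (f m f′ : List A) → (e ∷ f ++ m) ++ f′ ↭ e ∷ m ++ (f ++ f′)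
    pull-early e = solve 4 (λ e f m f′ → (e ⊕ f ⊕ m) ⊕ f′ ⊜ e ⊕ m ⊕ (f ⊕ f′)) ↭-refl [ e ]

    late : (b n b′ : List A) → b ++ (n ++ b′) ↭ n ++ (b ++ b′)
    late = solve 3 (λ b n b′ → b ⊕ (n ⊕ b′) ⊜ n ⊕ (b ⊕ b′)) ↭-refl

    early : (b n b′ : List A) → (b ++ n) ++ b′ ↭ n ++ (b ++ b′)
    early = solve 3 (λ b n b′ → (b ⊕ n) ⊕ b′ ⊜ n ⊕ (b ⊕ b′)) ↭-refl

  map-mid : ∀ {A : Set} (k : Edge → A) as e bs → map k as ++ k e ∷ map k bs ↭ map k (as ++ e ∷ bs)
  map-mid k as e bs = ↭-reflexive (sym (map-++ k as (e ∷ bs)))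

  -- The walk runs through e₁ and later through e₂; joining the outer ends of e₁ and e₂ cuts out the
  -- stretch between them as a second segment.
  shortcut : ∀ {a z e₁ e₂ fs f b m n f′ b′ α β γ δ} →
             Walk (inj₁ a) (inj₁ (src e₁)) f b → Walk (inj₂ (tgt e₁)) (inj₁ (src e₂)) m n →
             Walk (inj₂ (tgt e₂)) (inj₂ z) f′ b′ → fs ↭ e₁ ∷ e₂ ∷ m ++ (f ++ f′) → Spans fs Xs Ys →
             H α (src e₁) (tgt e₂) ≡ true →
             Rainbow (α ∷ β ∷ γ ∷ δ ∷ []) ((m ++ (f ++ f′)) ++ (n ++ (b ++ b′))) → HamPath ⊎ Separated
  shortcut {e₁ = e₁} {e₂} {fs} {f} {b} {m} {n} {f′} {b′} {α} W₁ M W₂ fs↭ (spans σ τ) h V =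
    two-paths
      (vertices src σ refl (prep _ ↭-refl) (xs↭src∷ (rev M) spans-self))
      (vertices tgt τ refl (swap (tgt e₁) (tgt e₂) ↭-refl) (ys↭tgt∷ (rev M) spans-self))
      (path (W₁ ⊙ fwd g W₂) spans-self ↭-refl) (path (rev M) spans-self ↭-refl)
      (rainbow-resp ↭-refl (edges↭ g m f f′ n b b′) (use h V))
    where
    g = edge α (src e₁) (tgt e₂)
    vertices : ∀ {A : Set} (k : Edge → A) {as a a′} → map k fs ↭ as → k g ≡ a →
               k e₁ ∷ k e₂ ∷ map k (m ++ (f ++ f′)) ↭ a ∷ a′ ∷ map k (m ++ (f ++ f′)) →
               map k n ↭ a′ ∷ map k m → as ↭ map k (f ++ g ∷ f′) ++ map k n
    vertices k {a′ = a′} σ refl ρ υ =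
      ↭-trans (↭-sym σ) (↭-trans (map⁺ k fs↭) (↭-trans ρ
        (↭-trans (prep _ (prep _ (↭-reflexive (trans (map-++ k m (f ++ f′)) (cong (map k m ++_) (map-++ k f f′))))))
          (↭-trans (vertices↭ (k g) a′ (map k m) (map k f) (map k f′))
            (++⁺ (map-mid k f g f′) (↭-sym υ))))))

  -- A lost backward edge leaves two balanced paths. A lost forward edge is recoloured with `α` if
  -- possible; otherwise an `α`-edge from one of its ends across the gap rebalances the pieces by
  -- `shortcut`.
  repair : ∀ {a b es e₀ es′ α β} → Path a b Xs Ys es → es ↭ e₀ ∷ es′ → Rainbow (α ∷ β ∷ col e₀ ∷ []) es′ →
           HamPath ⊎ Separated
  repair {a} {b} {es} {e₀} {es′} {α} {β} (path {fs} {bs} W sp es↭) ρ V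
    with ∈-++⁻ fs (∈-resp-↭ (↭-sym (↭-trans es↭ ρ)) (here refl))
  ... | inj₂ e₀∈bs with split-bwd {e = e₀} W sp e₀∈bs
  ...   | pathSplit B A xs↭ ys↭ es↭′ = two-paths xs↭ ys↭ B A
            (rainbow-resp ↭-refl (drop-∷ (↭-trans (↭-sym (↭-trans es↭ ρ)) es↭′)) V)
  repair {a} {b} {es} {e₀} {es′} {α} {β} (path {fs} {bs} W sp es↭) ρ V
      | inj₁ e₀∈fs with split-at W e₀∈fs
  ...   | split {f₁} {b₁} {f₂} {b₂} B A fs↭ bs↭ = by-cases _ refl
    where
    u = src e₀
    v = tgt e₀
    es′↭ : es′ ↭ (f₁ ++ f₂) ++ (b₁ ++ b₂)
    es′↭ = drop-∷ (↭-trans (↭-sym (↭-trans es↭ ρ)) (++⁺ fs↭ bs↭))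

    by-cases : ∀ i → H α u v ≡ i → HamPath ⊎ Separated
    by-cases true u∼v = inj₁ (toHamPath ↭-refl ↭-refl
      (path (B ⊙ fwd (edge α u v) A) (spans (↭-trans (↭-trans (↭-sym (map-mid src f₁ (edge α u v) f₂)) (↭-trans (map-mid src f₁ e₀ f₂) (map⁺ src τ))) (Spans.srcs↭ sp))
                                          (↭-trans (↭-trans (↭-sym (map-mid tgt f₁ (edge α u v) f₂)) (↭-trans (map-mid tgt f₁ e₀ f₂) (map⁺ tgt τ))) (Spans.tgts↭ sp)))
        (↭-trans (++⁺ʳ (b₁ ++ b₂) (shift _ f₁ f₂)) (prep _ (↭-sym es′↭))))
      (use u∼v V))
      where
      τ : f₁ ++ e₀ ∷ f₂ ↭ fs
      τ = ↭-trans (shift e₀ f₁ f₂) (↭-sym fs↭)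
    by-cases false u≁v with search (H α u ∘ tgt) f₂ | search (λ e → H α (src e) v) f₁
    ... | inj₁ (e , e∈ , u∼e) | _ with split-at A e∈
    ...   | split {m} {n} {f′} {b′} M A′ f₂↭ b₂↭ =
      shortcut {e₁ = e₀} {e} B M A′ (↭-trans fs↭ (prep e₀ late-f)) sp u∼e
        (rainbow-resp (swap (col e) α ↭-refl) ↭-refl (discard {e = e}
          (rainbow-resp ↭-refl (↭-trans es′↭ (++⁺ late-f (↭-trans (++⁺ˡ b₁ b₂↭) (late b₁ n b′)))) V)))
      where
      late-f : f₁ ++ f₂ ↭ e ∷ m ++ (f₁ ++ f′)
      late-f = ↭-trans (++⁺ˡ f₁ f₂↭) (pull-late e f₁ m f′)
    by-cases false u≁v | _ | inj₁ (e , e∈ , e∼v) with split-at B e∈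
    ...   | split {f} {b} {m} {n} B′ M f₁↭ b₁↭ =
      shortcut {e₁ = e} {e₀} B′ M A (↭-trans fs↭ (↭-trans (prep e₀ early-f) (swap e₀ e ↭-refl))) sp e∼v
        (rainbow-resp (swap (col e) α ↭-refl) ↭-refl (discard {e = e}
          (rainbow-resp ↭-refl (↭-trans es′↭ (++⁺ early-f (↭-trans (++⁺ʳ b₂ b₁↭) (early b n b₂)))) V)))
      where
      early-f : f₁ ++ f₂ ↭ e ∷ m ++ (f ++ f₂)
      early-f = ↭-trans (++⁺ʳ f₂ f₁↭) (pull-early e f m f₂)
    -- With no such edge, the neighbours of `u` lie on edges of `f₁` and those of `v` on edges of
    -- `f₂`; together with `e₀` this makes more than `κ + κ` forward edges.
    by-cases false u≁v | inj₂ none₂ | inj₂ none₁ = ⊥-elim (ℕ.<-irrefl refl (begin-strict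
      length Ys ≤⟨ |Ys|≤2κ ⟩
      κ + κ ≤⟨ ℕ.+-mono-≤ κ≤|f₁| κ≤|f₂| ⟩
      length f₁ + length f₂ <⟨ ℕ.n<1+n _ ⟩
      suc (length f₁ + length f₂) ≡⟨ cong suc (sym (length-++ f₁)) ⟩
      length (e₀ ∷ f₁ ++ f₂) ≡⟨ sym (↭-length fs↭) ⟩
      length fs ≡⟨ length-tgt sp ⟩
      length Ys ∎))
      where
      open ℕ.≤-Reasoning
      κ≤|f₁| : κ ≤ length f₁
      κ≤|f₁| = ℕ.≤-trans (subst (κ ≤_) (trans (count-tgt _ sp) (trans (count-drop fs↭ u≁v) (count-only {bs = f₁} ↭-refl none₂)))
                 (degX α (∈-resp-↭ (Spans.srcs↭ sp) (∈-map⁺ src e₀∈fs)))) (count≤length _ f₁)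
      κ≤|f₂| : κ ≤ length f₂
      κ≤|f₂| = ℕ.≤-trans (subst (κ ≤_) (trans (count-src _ sp) (trans (count-drop fs↭ u≁v) (count-only {bs = f₂} (++-rotate f₁ f₂) none₁)))
                 (degY α (∈-resp-↭ (Spans.tgts↭ sp) (∈-map⁺ tgt e₀∈fs)))) (count≤length _ f₂)

-- Removing added edges one at a time

module Saturation
  (C X Y : Set)
  (_≟ᶜ_ : DecidableEquality C) (_≟ˣ_ : DecidableEquality X) (_≟ʸ_ : DecidableEquality Y)
  (G : C → X → Y → Bool)
  (Xs : List X) (Ys : List Y) (Cs : List C) (Cs! : Unique Cs) (κ : ℕ) (|Ys|≤2κ : length Ys ≤ κ + κ)
  (degX : ∀ c {a} → a ∈ Xs → κ ≤ count (G c a) Ys)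
  (degY : ∀ c {b} → b ∈ Ys → κ ≤ count (λ a → G c a b) Xs)
  where
  open Paths C X Y

  _≟ᵉ_ : DecidableEquality Edge
  edge c a b ≟ᵉ edge c′ a′ b′ with c ≟ᶜ c′ | a ≟ˣ a′ | b ≟ʸ b′
  ... | yes refl | yes refl | yes refl = yes refl
  ... | no c≢    | _        | _        = no λ { refl → c≢ refl }
  ... | yes _    | no a≢    | _        = no λ { refl → a≢ refl }
  ... | yes _    | yes _    | no b≢    = no λ { refl → b≢ refl }

  -- Adjacency in the collection `G` enlarged by the coloured edges in the list; dropping the head
  -- of the list withdraws one added edge.
  _⊕_ : List Edge → Edge → Bool
  []       ⊕ e = G (col e) (src e) (tgt e)
  (l ∷ ls) ⊕ e with e ≟ᵉ l
  ... | yes _ = true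
  ... | no  _ = ls ⊕ e

  enlarged : List Edge → C → X → Y → Bool
  enlarged L c a b = L ⊕ edge c a b

  enlarges : ∀ L e → G (col e) (src e) (tgt e) ≡ true → L ⊕ e ≡ true
  enlarges []      e h = h
  enlarges (l ∷ L) e h with e ≟ᵉ l
  ... | yes _ = refl
  ... | no  _ = enlarges L e h

  contains : ∀ {L e} → e ∈ L → L ⊕ e ≡ true
  contains {l ∷ L} {e} e∈ with e ≟ᵉ l | e∈
  ... | yes _  | _          = refl
  ... | no e≢l | here e≡l   = ⊥-elim (e≢l e≡l)
  ... | no _   | there e∈L  = contains e∈L

  𝟙-mono : ∀ {b c} → (b ≡ true → c ≡ true) → 𝟙 b ≤ 𝟙 c
  𝟙-mono {false} h = z≤n
  𝟙-mono {true}  h rewrite h refl = ℕ.≤-refl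

  module Seg (L : List Edge) = Segments C X Y (enlarged L) Xs Ys Cs κ |Ys|≤2κ
    (λ c a∈ → ℕ.≤-trans (degX c a∈) (∑-mono {as = Ys} (λ _ → 𝟙-mono (enlarges L _))))
    (λ c b∈ → ℕ.≤-trans (degY c b∈) (∑-mono {as = Xs} (λ _ → 𝟙-mono (enlarges L _))))

  open Seg using (HamPath; Separated)

  -- Absence of edges passes to subgraphs, and the sizes of the halves do not depend on the graphs.
  restrict : ∀ L → Separated L → Separated []
  restrict L (Seg.separated σ τ p q r s apart) = Seg.separated {L = []} σ τ p q r s λ c∈ →
    (λ a∈ b∈ → absent (proj₁ (apart c∈) a∈ b∈)) , (λ a∈ b∈ → absent (proj₂ (apart c∈) a∈ b∈))
    where
    absent : ∀ {e} → L ⊕ e ≡ false → G (col e) (src e) (tgt e) ≡ false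
    absent {e} ¬h with G (col e) (src e) (tgt e) in h
    ... | false = refl
    ... | true  = ⊥-elim (false≢true ¬h (enlarges L e h))

  -- Only `l` itself can become invalid, and its colour occurs at most once on a rainbow path. All
  -- other edges survive, and `repair` applies with that colour free.
  remove : ∀ l L → HamPath (l ∷ L) → HamPath L ⊎ Separated L
  remove l L (Seg.hamPath {es = es} {α} {β} P valid ρ) with search (λ e → not (L ⊕ e)) es
  ... | inj₂ all = inj₁ (Seg.hamPath {L = L} P (All.tabulate (λ e∈ → not-injective (all e∈))) ρ)
  ... | inj₁ (e , e∈ , ¬e) with ∈⇒↭ e∈
  ...   | es′ , σ = Seg.repair L P σ (Seg.rainbow {L = L} (All.tabulate (λ e′∈ → others e′∈ _ refl)) ρ′)
    where
    ρ′ : α ∷ β ∷ col e ∷ colours es′ ↭ Cs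
    ρ′ = ↭-trans (prep α (prep β (map⁺ col (↭-sym σ)))) ρ

    is-l : ∀ {e′} → e′ ∈ es → L ⊕ e′ ≡ false → e′ ≡ l
    is-l {e′} e′∈ ¬e′ with e′ ≟ᵉ l | All.lookup valid e′∈
    ... | yes eq | _ = eq
    ... | no  _  | h = ⊥-elim (false≢true ¬e′ h)

    others : ∀ {e′} → e′ ∈ es′ → ∀ i → L ⊕ e′ ≡ i → L ⊕ e′ ≡ true
    others e′∈ true  h  = h
    others e′∈ false ¬h with is-l (∈-resp-↭ (↭-sym σ) (there e′∈)) ¬h | is-l e∈ (not-injective ¬e)
    ... | refl | refl with Unique-resp-↭ (↭-sym ρ′) Cs!
    ...   | _ ∷ _ ∷ fresh ∷ _ = ⊥-elim (All.lookup fresh (∈-map⁺ col e′∈) refl)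

  descend : ∀ L → HamPath L → HamPath [] ⊎ Separated []
  descend []      P = inj₁ P
  descend (l ∷ L) P with remove l L P
  ... | inj₁ Q = descend L Q
  ... | inj₂ S = inj₂ (restrict L S)

  zigzag : ∀ a as b bs c cs → length bs ≡ length as → length cs ≡ length as + length as →
           ∃ λ v → ∃ λ es → Path a v (a ∷ as) (b ∷ bs) es × colours es ↭ c ∷ cs
  zigzag a [] b [] c [] _ _ = b , _ , path (fwd (edge c a b) stop) spans-self ↭-refl , ↭-refl
  zigzag a (a′ ∷ as) b (b′ ∷ bs) c (c′ ∷ []) _ eq with () ← trans eq (cong suc (ℕ.+-suc (length as) _))
  zigzag a (a′ ∷ as) b (b′ ∷ bs) c (c′ ∷ c″ ∷ cs) |bs| |cs|
    with zigzag a′ as b′ bs c″ cs (ℕ.suc-injective |bs|)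
           (ℕ.suc-injective (ℕ.suc-injective (trans |cs| (cong suc (ℕ.+-suc (length as) _)))))
  ... | v , es , P , ρ = v , _ , join (path (fwd (edge c a b) stop) spans-self ↭-refl) c′ P
                           , ↭-trans (swap c′ c ↭-refl) (prep c (prep c′ ρ))

  -- The zigzag through `as` and `bs` needs two colours fewer than `cs` offers; the first two are
  -- set aside.
  spanning-path : ∀ as bs cs → 0 < length as → length bs ≡ length as → length cs ≡ suc (length as + length as) →
                  ∃ λ a → ∃ λ v → ∃ λ α → ∃ λ β → ∃ λ es → Path a v as bs es × α ∷ β ∷ colours es ↭ cs
  spanning-path (a ∷ as) (b ∷ bs) (c₁ ∷ c₂ ∷ []) _ _ eq
    with () ← trans (ℕ.suc-injective (ℕ.suc-injective eq)) (ℕ.+-suc (length as) _)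
  spanning-path (a ∷ as) (b ∷ bs) (c₁ ∷ c₂ ∷ c₃ ∷ cs) _ |bs| |cs|
    with zigzag a as b bs c₃ cs (ℕ.suc-injective |bs|)
           (ℕ.suc-injective (trans (ℕ.suc-injective (ℕ.suc-injective |cs|)) (ℕ.+-suc (length as) _)))
  ... | v , es , P , ρ = a , v , c₁ , c₂ , es , P , prep c₁ (prep c₂ ρ)

  ham-or-separated : 0 < length Xs → length Ys ≡ length Xs → length Cs ≡ suc (length Xs + length Xs) →
                     HamPath [] ⊎ Separated []
  ham-or-separated 0<|Xs| |Ys| |Cs| with spanning-path Xs Ys Cs 0<|Xs| |Ys| |Cs|
  ... | a , v , α , β , es , P , ρ = descend all-edges (Seg.hamPath {L = all-edges} P
        (All.tabulate λ e∈ → contains (∈-map⁺ _ (∈-cartesianProduct⁺ (∈-resp-↭ ρ (there (there (∈-map⁺ col e∈))))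
          (∈-cartesianProduct⁺ (edge-src∈ P e∈) (edge-tgt∈ P e∈))))) ρ)
    where
    all-edges : List Edge
    all-edges = map (λ (c , a , b) → edge c a b) (cartesianProduct Cs (cartesianProduct Xs Ys))

-- From walks to paths as functions

module Realisation {n m : ℕ} (Gs : Fin m → BipGraph n) where
  open Paths (Fin m) (Fin n) (Fin n)

  Present : Edge → Set
  Present e = Gs (col e) (src e) (tgt e) ≡ true

  -- The lists of a `Walk` matter only up to order; here vertices and edges are listed as traversed,
  -- so that positions can index them.
  data Trail : Vertex n → Vertex n → List (Vertex n) → List Edge → Set where
    end : ∀ {u} → Trail u u [ u ] []
    via : ∀ e {u w v vs es} → Adj (Gs (col e)) u w → Trail w v vs es → Trail u v (u ∷ vs) (e ∷ es)

  -- A vertex of `X` is listed when left by a forward edge or at the end, a vertex of `Y` when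
  -- entered by one or at the start.
  trail : ∀ {u v fs bs} → Walk u v fs bs → All Present fs → All Present bs →
          ∃ λ vs → ∃ λ es → Trail u v vs es × es ↭ fs ++ bs ×
            vs ↭ map inj₁ (srcs fs ++ endX v) ++ map inj₂ (endY u ++ tgts fs)
  trail {inj₁ a} stop _ _ = _ , _ , end , ↭-refl , ↭-refl
  trail {inj₂ b} stop _ _ = _ , _ , end , ↭-refl , ↭-refl
  trail (fwd e W) (h ∷ F) B with trail W F B
  ... | _ , _ , t , ρ , σ = _ , _ , via e h t , prep e ρ , prep (inj₁ (src e)) σ
  trail {v = v} (bwd e {fs = fs} {bs} W) F (h ∷ B) with trail W F B
  ... | _ , _ , t , ρ , σ = _ , _ , via e h t , ↭-trans (prep e ρ) (↭-sym (shift e fs bs))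
      , ↭-trans (prep _ σ) (↭-sym (shift (inj₂ (tgt e)) (map inj₁ (srcs fs ++ endX v)) _))
  trail {u} {v} (perm σ τ W) F B with trail W (All-resp-↭ (↭-sym σ) F) (All-resp-↭ (↭-sym τ) B)
  ... | _ , _ , t , ρ , υ = _ , _ , t , ↭-trans ρ (++⁺ σ τ)
      , ↭-trans υ (++⁺ (map⁺ inj₁ (++⁺ʳ (endX v) (map⁺ src σ))) (map⁺ inj₂ (++⁺ˡ (endY u) (map⁺ tgt σ))))

  vertex : ∀ {u v vs es} → Trail u v vs es → Fin (suc (length es)) → Vertex n
  vertex {u} t           zero    = u
  vertex     (via _ _ t) (suc i) = vertex t i

  vertex-last : ∀ {u v vs es} (t : Trail u v vs es) → vertex t (fromℕ (length es)) ≡ v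
  vertex-last end         = refl
  vertex-last (via _ _ t) = vertex-last t

  vertex-∈ : ∀ {u v vs es} (t : Trail u v vs es) i → vertex t i ∈ vs
  vertex-∈ end         zero    = here refl
  vertex-∈ (via _ _ t) zero    = here refl
  vertex-∈ (via _ _ t) (suc i) = there (vertex-∈ t i)

  vertex-injective : ∀ {u v vs es} (t : Trail u v vs es) → Unique vs → ∀ {i j} → vertex t i ≡ vertex t j → i ≡ j
  vertex-injective t           _            {zero}  {zero}  _  = refl
  vertex-injective (via _ _ t) (fresh ∷ _)  {zero}  {suc j} eq = ⊥-elim (All.lookup fresh (vertex-∈ t j) eq)
  vertex-injective (via _ _ t) (fresh ∷ _)  {suc i} {zero}  eq = ⊥-elim (All.lookup fresh (vertex-∈ t i) (sym eq))
  vertex-injective (via _ _ t) (_ ∷ unique) {suc i} {suc j} eq = cong suc (vertex-injective t unique eq)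

  vertex-surjective : ∀ {u v vs es} (t : Trail u v vs es) {w} → w ∈ vs → ∃ λ i → vertex t i ≡ w
  vertex-surjective end         (here refl) = zero , refl
  vertex-surjective (via _ _ t) (here refl) = zero , refl
  vertex-surjective (via _ _ t) (there w∈)  with vertex-surjective t w∈
  ... | i , eq = suc i , eq

  vertex-adjacent : ∀ {u v vs es} (t : Trail u v vs es) i →
                    Adj (Gs (col (lookup es i))) (vertex t (inject₁ i)) (vertex t (suc i))
  vertex-adjacent (via e h end)          zero = h
  vertex-adjacent (via e h (via _ _ _))  zero = h
  vertex-adjacent (via e h t@(via _ _ _)) (suc i) = vertex-adjacent t i

  colour-injective : ∀ es → Unique (colours es) → ∀ {i j} → col (lookup es i) ≡ col (lookup es j) → i ≡ j
  colour-injective (e ∷ es) _ {zero} {zero} _ = refl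
  colour-injective (e ∷ es) (fresh ∷ _) {zero}  {suc j} eq = ⊥-elim (All.lookup fresh (∈-map⁺ col (∈-lookup {xs = es} j)) eq)
  colour-injective (e ∷ es) (fresh ∷ _) {suc i} {zero}  eq = ⊥-elim (All.lookup fresh (∈-map⁺ col (∈-lookup {xs = es} i)) (sym eq))
  colour-injective (e ∷ es) (_ ∷ unique) {suc i} {suc j} eq = cong suc (colour-injective es unique eq)

  rainbowHamPath : ∀ {x y fs bs} → Walk (inj₁ x) (inj₂ y) fs bs → All Present (fs ++ bs) →
                   srcs fs ↭ allFin n → tgts fs ↭ allFin n → Unique (colours (fs ++ bs)) →
                   RainbowHamPath Gs (inj₁ x) (inj₂ y)
  rainbowHamPath {fs = fs} W present σ τ colours! with trail W (Allₚ.++⁻ˡ fs present) (Allₚ.++⁻ʳ fs present)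
  ... | vs , es , t , ρ , υ =
    length es , vertex t , vertex-injective t vs!
      , (λ w → let i , eq = vertex-surjective t (∈vs w) in i , λ { refl → eq })
      , refl , vertex-last t
      , (λ i → col (lookup es i)) , colour-injective es (Unique-resp-↭ (map⁺ col (↭-sym ρ)) colours!)
      , vertex-adjacent t
    where
    all-vertices : vs ↭ map inj₁ (allFin n) ++ map inj₂ (allFin n)
    all-vertices = ↭-trans υ (++⁺ (map⁺ inj₁ (↭-trans (++-identityʳ _) σ)) (map⁺ inj₂ τ))

    vs! : Unique vs
    vs! = Unique-resp-↭ (↭-sym all-vertices)
      (Unique.++⁺ (Unique.map⁺ inj₁-injective (Unique.allFin⁺ n)) (Unique.map⁺ inj₂-injective (Unique.allFin⁺ n))
        λ { (p , q) → disjoint (∈-map⁻ inj₁ p) (∈-map⁻ inj₂ q) })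
      where
      disjoint : ∀ {v : Vertex n} {as bs : List (Fin n)} → (∃ λ a → a ∈ as × v ≡ inj₁ a) → (∃ λ b → b ∈ bs × v ≡ inj₂ b) → ⊥
      disjoint (_ , _ , refl) (_ , _ , ())

    ∈vs : ∀ w → w ∈ vs
    ∈vs (inj₁ a) = ∈-resp-↭ (↭-sym all-vertices) (∈-++⁺ˡ (∈-map⁺ inj₁ (∈-allFin a)))
    ∈vs (inj₂ b) = ∈-resp-↭ (↭-sym all-vertices) (∈-++⁺ʳ (map inj₁ (allFin n)) (∈-map⁺ inj₂ (∈-allFin b)))

-- The extremal graphs

module _ {n : ℕ} where
  open import Data.List.Membership.DecPropositional (_≟_ {n}) public using (_∈?_)

countTrue≡count : ∀ {n} (p : Fin n → Bool) → countTrue p ≡ count p (allFin n)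
countTrue≡count p = go p (λ i → i)
  where
  go : ∀ {n k} (p : Fin k → Bool) (f : Fin n → Fin k) → countTrue (λ i → p (f i)) ≡ count p (tabulate f)
  go {zero}  p f = refl
  go {suc n} p f with p (f zero)
  ... | true  = cong suc (go p (f ∘ suc))
  ... | false = go p (f ∘ suc)

∣tabulate∣ : ∀ {n} (p : Fin n → Bool) → Subset.∣ Vec.tabulate p ∣ ≡ countTrue p
∣tabulate∣ {zero}  p = refl
∣tabulate∣ {suc n} p with p zero
... | true  = cong suc (∣tabulate∣ (p ∘ suc))
... | false = ∣tabulate∣ (p ∘ suc)

Unique⇒disjoint : {A : Set} (as : List A) {bs : List A} {a : A} → Unique (as ++ bs) → a ∈ as → a ∈ bs → ⊥
Unique⇒disjoint (_ ∷ as) (fresh ∷ _)  (here refl) a∈bs = All.lookup fresh (∈-++⁺ʳ as a∈bs) refl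
Unique⇒disjoint (_ ∷ as) (_ ∷ unique) (there a∈)  a∈bs = Unique⇒disjoint as unique a∈ a∈bs

module Halves {n : ℕ} {p : Fin n} {as bs : List (Fin n)} (σ : p ∷ as ++ bs ↭ allFin n) where

  all! : Unique (p ∷ as ++ bs)
  all! = Unique-resp-↭ (↭-sym σ) (Unique.allFin⁺ n)

  member : Fin n → Bool
  member i = does (i ∈? as)

  half : Subset.Subset n
  half = Vec.tabulate member

  ∈⇒∈half : ∀ {i} → i ∈ as → i Subset.∈ half
  ∈⇒∈half {i} i∈ = Vec.lookup⇒[]= i half (trans (Vec.lookup∘tabulate member i) (dec-true (i ∈? as) i∈))

  ∈half⇒∈ : ∀ {i} → i Subset.∈ half → i ∈ as
  ∈half⇒∈ {i} i∈ with i ∈? as | trans (sym (Vec.lookup∘tabulate member i)) (Vec.[]=⇒lookup i∈)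
  ... | yes i∈as | _ = i∈as
  ... | no  _    | ()

  p∉half : p Subset.∉ half
  p∉half p∈ = Unique⇒disjoint [ p ] all! (here refl) (∈-++⁺ˡ (∈half⇒∈ p∈))

  as∩bs : ∀ {i} → i ∈ as → i ∈ bs → ⊥
  as∩bs with all!
  ... | _ ∷ unique = Unique⇒disjoint as unique

  cases : ∀ i → i ≡ p ⊎ i ∈ as ⊎ i ∈ bs
  cases i with ∈-resp-↭ (↭-sym σ) (∈-allFin i)
  ... | here eq  = inj₁ eq
  ... | there i∈ = inj₂ (∈-++⁻ as i∈)

  ∣half∣ : Subset.∣ half ∣ ≡ length as
  ∣half∣ = begin
    Subset.∣ half ∣              ≡⟨ ∣tabulate∣ member ⟩
    countTrue member             ≡⟨ countTrue≡count member ⟩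
    count member (allFin n)      ≡⟨ count-drop (↭-sym σ) (dec-false (p ∈? as) λ p∈ → Unique⇒disjoint [ p ] all! (here refl) (∈-++⁺ˡ p∈)) ⟩
    count member (as ++ bs)      ≡⟨ count-only {bs = as} ↭-refl (λ {i} i∈ → dec-false (i ∈? as) λ i∈as → as∩bs i∈as i∈) ⟩
    count member as              ≡⟨ ℕ.≤-antisym (count≤length member as) (count-≥ as λ {i} i∈ → dec-true (i ∈? as) i∈) ⟩
    length as                    ∎
    where
    open ≡-Reasoning
    count-≥ : ∀ is {q : Fin n → Bool} → (∀ {i} → i ∈ is → q i ≡ true) → length is ≤ count q is
    count-≥ []       all = z≤n
    count-≥ (i ∷ is) all rewrite all (here refl) = s≤s (count-≥ is (all ∘ there))

-- The dichotomy for fixed ends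

module FixedEnds {m : ℕ} (Gs : Fin (suc (suc m) + suc (suc m) ∸ 1) → BipGraph (suc (suc m)))
  (mindeg : ∀ i → MinDegAtLeast (Gs i) ⌈ suc (suc m) + 1 /2⌉)
  (x y : Fin (suc (suc m))) (Xs Ys : List (Fin (suc (suc m))))
  (Xs↭ : x ∷ Xs ↭ allFin (suc (suc m))) (Ys↭ : y ∷ Ys ↭ allFin (suc (suc m))) where

  n M κ : ℕ
  n = suc (suc m)
  M = n + n ∸ 1
  κ = ⌊ n /2⌋

  -- After commuting, `⌈ 1 + n /2⌉` computes to `suc ⌊ n /2⌋`.
  δ≡ : ⌈ n + 1 /2⌉ ≡ suc κ
  δ≡ = cong ⌈_/2⌉ (ℕ.+-comm n 1)

  length-others : ∀ {z zs} → z ∷ zs ↭ allFin n → length zs ≡ suc m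
  length-others σ = ℕ.suc-injective (trans (↭-length σ) (length-tabulate (λ i → i)))

  |Ys| = length-others Ys↭

  |Ys|≤2κ : length Ys ≤ κ + κ
  |Ys|≤2κ = begin
    length Ys                  ≡⟨ |Ys| ⟩
    -- As `n` is `suc (suc m)`, `κ` is definitionally `⌈ suc m /2⌉`.
    suc m                      ≡⟨ sym (ℕ.⌊n/2⌋+⌈n/2⌉≡n (suc m)) ⟩
    ⌊ suc m /2⌋ + κ            ≤⟨ ℕ.+-monoˡ-≤ κ (ℕ.⌊n/2⌋≤⌈n/2⌉ (suc m)) ⟩
    κ + κ                      ∎
    where open ℕ.≤-Reasoning

  degree-X : ∀ c a → suc κ ≤ 𝟙 (Gs c a y) + count (Gs c a) Ys
  degree-X c a = subst₂ _≤_ δ≡ (trans (countTrue≡count (Gs c a)) (count-↭ (↭-sym Ys↭))) (proj₁ (mindeg c) a)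

  degree-Y : ∀ c b → suc κ ≤ 𝟙 (Gs c x b) + count (λ a → Gs c a b) Xs
  degree-Y c b = subst₂ _≤_ δ≡ (trans (countTrue≡count (λ a → Gs c a b)) (count-↭ (↭-sym Xs↭))) (proj₂ (mindeg c) b)

  open Paths (Fin M) (Fin n) (Fin n)
  module Complete = Completion (Fin M) (Fin n) (Fin n) Gs Xs Ys (allFin M) x y κ (s≤s z≤n) |Ys|≤2κ
    (λ c {a} _ → degree-X c a) (λ c {b} _ → degree-Y c b) (λ c → drop-𝟙 _ (degree-X c x)) (λ c → drop-𝟙 _ (degree-Y c y))
  module Saturate = Saturation (Fin M) (Fin n) (Fin n) _≟_ _≟_ _≟_ Gs Xs Ys (allFin M) (Unique.allFin⁺ M) κ |Ys|≤2κ
    (λ c {a} _ → drop-𝟙 _ (degree-X c a)) (λ c {b} _ → drop-𝟙 _ (degree-Y c b))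
  open Saturate using (module Seg)

  realise : Complete.Completed → RainbowHamPath Gs (inj₁ x) (inj₂ y)
  realise (Complete.completed {a} {b} {es} {α} {β} (path {fs} {bs} W sp es↭) valid rainbow a∼y x∼b) =
    -- Between `x` and `y` the inner path is run from `b` to `a`, so its backward edges become
    -- forward edges.
    rainbowHamPath (fwd g (rev W ⊙ fwd h stop)) (All-resp-↭ (↭-sym σ) (x∼b ∷ a∼y ∷ valid))
      (↭-trans (prep x (↭-trans (map⁺ src (↭-sym (∷↭∷ʳ h bs))) (↭-sym (xs↭src∷ W sp)))) Xs↭)
      (↭-trans (prep b (map⁺ tgt (↭-sym (∷↭∷ʳ h bs)))) (↭-trans (swap b y ↭-refl)
        (↭-trans (prep y (↭-sym (ys↭tgt∷ W sp))) Ys↭)))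
      (Unique-resp-↭ (↭-trans (↭-sym rainbow) (↭-trans (swap α β ↭-refl) (map⁺ col (↭-sym σ)))) (Unique.allFin⁺ M))
    where
    open Realisation Gs
    g = edge β x b
    h = edge α a y
    σ : (g ∷ bs ++ [ h ]) ++ (fs ++ []) ↭ g ∷ h ∷ es
    σ = prep g (↭-trans (++⁺ (↭-sym (∷↭∷ʳ h bs)) (++-identityʳ fs)) (prep h (↭-trans (++-rotate bs fs) es↭)))

  module Extremal (S : Seg.Separated []) where
    open Seg.Separated [] S renaming (Xs↭ to Xs-split; Ys↭ to Ys-split)

    private
      module HX₁ = Halves {p = x} {xs₁} {xs₂} (↭-trans (prep x (↭-sym Xs-split)) Xs↭)
      module HX₂ = Halves {p = x} {xs₂} {xs₁} (↭-trans (prep x (↭-sym (↭-trans Xs-split (++-rotate xs₁ xs₂)))) Xs↭)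
      module HY₁ = Halves {p = y} {ys₁} {ys₂} (↭-trans (prep y (↭-sym Ys-split)) Ys↭)
      module HY₂ = Halves {p = y} {ys₂} {ys₁} (↭-trans (prep y (↭-sym (↭-trans Ys-split (++-rotate ys₁ ys₂)))) Ys↭)

    n≡ : n ≡ suc (κ * 2)
    n≡ = cong suc (begin
      suc m                   ≡⟨ sym |Ys| ⟩
      length Ys               ≡⟨ ↭-length Ys-split ⟩
      length (ys₁ ++ ys₂)     ≡⟨ length-++ ys₁ ⟩
      length ys₁ + length ys₂ ≡⟨ cong₂ _+_ |ys₁| |ys₂| ⟩
      κ + κ                   ≡⟨ cong (κ +_) (sym (ℕ.+-identityʳ κ)) ⟩
      2 * κ                   ≡⟨ ℕ.*-comm 2 κ ⟩
      κ * 2                   ∎)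
      where open ≡-Reasoning

    odd : n % 2 ≡ 1
    odd = trans (cong (_% 2) n≡) ([m+kn]%n≡m%n 1 κ 2)

    size : ∀ {k} → k ≡ κ → k ≡ (n ∸ 1) / 2
    size k≡κ = trans k≡κ (trans (sym (m*n/n≡m κ 2)) (cong (λ n → (n ∸ 1) / 2) (sym n≡)))

    D : FData n
    D = record
      { xs = x ; ys = y
      ; X₁ = HX₁.half ; X₂ = HX₂.half ; Y₁ = HY₁.half ; Y₂ = HY₂.half
      ; xs∉X₁ = HX₁.p∉half ; xs∉X₂ = HX₂.p∉half ; ys∉Y₁ = HY₁.p∉half ; ys∉Y₂ = HY₂.p∉half
      ; X-disj = λ a p q → HX₁.as∩bs (HX₁.∈half⇒∈ p) (HX₂.∈half⇒∈ q)
      ; Y-disj = λ b p q → HY₁.as∩bs (HY₁.∈half⇒∈ p) (HY₂.∈half⇒∈ q)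
      ; X-cover = λ a a≢ → Sum.map HX₁.∈⇒∈half HX₂.∈⇒∈half (Sum.[ ⊥-elim ∘ a≢ , (λ z → z) ] (HX₁.cases a))
      ; Y-cover = λ b b≢ → Sum.map HY₁.∈⇒∈half HY₂.∈⇒∈half (Sum.[ ⊥-elim ∘ b≢ , (λ z → z) ] (HY₁.cases b))
      ; ∣X₁∣ = size (trans HX₁.∣half∣ |xs₁|) ; ∣X₂∣ = size (trans HX₂.∣half∣ |xs₂|)
      ; ∣Y₁∣ = size (trans HY₁.∣half∣ |ys₁|) ; ∣Y₂∣ = size (trans HY₂.∣half∣ |ys₂|)
      }

    -- Apart from `bs`, only `z` and the `κ` vertices of `as` remain as neighbours, exactly as many
    -- as the degree demands.
    saturated : ∀ {q : Fin n → Bool} {z as bs cs} → suc κ ≤ 𝟙 (q z) + count q cs → cs ↭ as ++ bs → length as ≡ κ →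
                (∀ {b} → b ∈ bs → q b ≡ false) → q z ≡ true × (∀ {a} → a ∈ as → q a ≡ true)
    saturated {q} {z} {as} {bs} {cs} deg σ |as| none with q z | subst (λ k → suc κ ≤ 𝟙 (q z) + k) (count-only σ none) deg
    ... | true  | s≤s le = refl , count-all (subst (_≤ count q as) (sym |as|) le)
    ... | false | le = ⊥-elim (ℕ.<-irrefl refl (ℕ.<-≤-trans le (subst (count q as ≤_) |as| (count≤length q as))))

    module _ (i : Fin M) where
      private
        G = Gs i
        apart₁₂ = proj₁ (apart (∈-allFin i))
        apart₂₁ = proj₂ (apart (∈-allFin i))
        full-X₁ : ∀ {a} → a ∈ xs₁ → G a y ≡ true × (∀ {b} → b ∈ ys₁ → G a b ≡ true)
        full-X₁ {a} a∈ = saturated (degree-X i a) Ys-split |ys₁| (apart₁₂ a∈)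
        full-X₂ : ∀ {a} → a ∈ xs₂ → G a y ≡ true × (∀ {b} → b ∈ ys₂ → G a b ≡ true)
        full-X₂ {a} a∈ = saturated (degree-X i a) (↭-trans Ys-split (++-rotate ys₁ ys₂)) |ys₂| (apart₂₁ a∈)
        full-Y₁ : ∀ {b} → b ∈ ys₁ → G x b ≡ true
        full-Y₁ {b} b∈ = proj₁ (saturated {q = λ a → G a b} (degree-Y i b) Xs-split |xs₁| (λ a∈ → apart₂₁ a∈ b∈))
        full-Y₂ : ∀ {b} → b ∈ ys₂ → G x b ≡ true
        full-Y₂ {b} b∈ = proj₁ (saturated {q = λ a → G a b} (degree-Y i b) (↭-trans Xs-split (++-rotate xs₁ xs₂)) |xs₂|
                                          (λ a∈ → apart₁₂ a∈ b∈))

      sound : ∀ a b → G a b ≡ true → F'Edge D a b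
      sound a b h with HX₁.cases a | HY₁.cases b
      ... | inj₁ a≡x        | inj₁ b≡y        = inj₂ (a≡x , b≡y)
      ... | inj₁ a≡x        | inj₂ (inj₁ b∈) = inj₁ (inj₁ (a≡x , inj₁ (HY₁.∈⇒∈half b∈)))
      ... | inj₁ a≡x        | inj₂ (inj₂ b∈) = inj₁ (inj₁ (a≡x , inj₂ (HY₂.∈⇒∈half b∈)))
      ... | inj₂ (inj₁ a∈) | inj₁ b≡y        = inj₁ (inj₂ (inj₁ (b≡y , inj₁ (HX₁.∈⇒∈half a∈))))
      ... | inj₂ (inj₂ a∈) | inj₁ b≡y        = inj₁ (inj₂ (inj₁ (b≡y , inj₂ (HX₂.∈⇒∈half a∈))))
      ... | inj₂ (inj₁ a∈) | inj₂ (inj₁ b∈) = inj₁ (inj₂ (inj₂ (inj₁ (HX₁.∈⇒∈half a∈ , HY₁.∈⇒∈half b∈))))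
      ... | inj₂ (inj₂ a∈) | inj₂ (inj₂ b∈) = inj₁ (inj₂ (inj₂ (inj₂ (HX₂.∈⇒∈half a∈ , HY₂.∈⇒∈half b∈))))
      ... | inj₂ (inj₁ a∈) | inj₂ (inj₂ b∈) = ⊥-elim (false≢true (apart₁₂ a∈ b∈) h)
      ... | inj₂ (inj₂ a∈) | inj₂ (inj₁ b∈) = ⊥-elim (false≢true (apart₂₁ a∈ b∈) h)

      full : ∀ a b → FEdge D a b → G a b ≡ true
      full a b (inj₁ (refl , inj₁ b∈)) = full-Y₁ (HY₁.∈half⇒∈ b∈)
      full a b (inj₁ (refl , inj₂ b∈)) = full-Y₂ (HY₂.∈half⇒∈ b∈)
      full a b (inj₂ (inj₁ (refl , inj₁ a∈))) = proj₁ (full-X₁ (HX₁.∈half⇒∈ a∈))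
      full a b (inj₂ (inj₁ (refl , inj₂ a∈))) = proj₁ (full-X₂ (HX₂.∈half⇒∈ a∈))
      full a b (inj₂ (inj₂ (inj₁ (a∈ , b∈)))) = proj₂ (full-X₁ (HX₁.∈half⇒∈ a∈)) (HY₁.∈half⇒∈ b∈)
      full a b (inj₂ (inj₂ (inj₂ (a∈ , b∈)))) = proj₂ (full-X₂ (HX₂.∈half⇒∈ a∈)) (HY₂.∈half⇒∈ b∈)

      -- The degrees and the separation decide every pair except `x`, `y`, and that pair
      -- distinguishes `F` from `F'`.
      classify : IsF D G ⊎ IsF' D G
      classify with G x y in x∼y
      ... | true  = inj₂ λ a b → sound a b , Sum.[ full a b , (λ { (refl , refl) → x∼y }) ]
      ... | false = inj₁ λ a b → (λ h → Sum.[ (λ e → e) , (λ { (refl , refl) → ⊥-elim (false≢true x∼y h) }) ] (sound a b h)) , full a b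

  dichotomy : RainbowHamPath Gs (inj₁ x) (inj₂ y) ⊎ (n % 2 ≡ 1 × Σ (FData n) λ D → ∀ i → IsF D (Gs i) ⊎ IsF' D (Gs i))
  dichotomy with Saturate.ham-or-separated (subst (0 <_) (sym |Xs|) (s≤s z≤n)) (trans |Ys| (sym |Xs|)) |Cs|
    where
    |Xs| = length-others Xs↭
    |Cs| : length (allFin M) ≡ suc (length Xs + length Xs)
    |Cs| = trans (length-tabulate (λ i → i)) (trans (ℕ.+-suc (suc m) (suc m)) (cong (λ k → suc (k + k)) (sym |Xs|)))
  ... | inj₁ (Seg.hamPath P valid rainbow) = inj₁ (realise (Complete.complete-path P valid rainbow))
  ... | inj₂ S = inj₂ (Extremal.odd S , Extremal.D S , Extremal.classify S)

-- The extremal alternative does not mention the prescribed ends, so a single pair that leads to it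
-- settles the whole collection.
choose-or : ∀ {n} {P : Fin n → Set} {Q : Set} → (∀ i → P i ⊎ Q) → (∀ i → P i) ⊎ Q
choose-or {zero}  each = inj₁ λ ()
choose-or {suc n} each with each zero | choose-or (each ∘ suc)
... | inj₂ q | _      = inj₂ q
... | inj₁ _ | inj₂ q = inj₂ q
... | inj₁ p | inj₁ r = inj₁ λ { zero → p ; (suc i) → r i }

theorem1p4 : (n : ℕ) → 0 < n → (Gs : Fin (n + n ∸ 1) → BipGraph n) →
    (∀ i → MinDegAtLeast (Gs i) ⌈ n + 1 /2⌉) →
    HamiltonianConnected Gs
    ⊎ (n % 2 ≡ 1 × Σ (FData n) λ D → ∀ i → IsF D (Gs i) ⊎ IsF' D (Gs i))
-- For `n = 1` nothing remains between the ends and `κ` would be 0; the path is the single edge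
-- forced by the degree.
theorem1p4 (suc zero) _ Gs mindeg = inj₁ single
  where
  open Realisation Gs
  open Walks (Fin 1) (Fin 1) (Fin 1)
  present : Gs zero zero zero ≡ true
  present with Gs zero zero zero | proj₁ (mindeg zero) zero
  ... | true  | _ = refl
  ... | false | ()
  single : HamiltonianConnected Gs
  single zero zero = rainbowHamPath (fwd (edge zero zero zero) stop) (present ∷ []) ↭-refl ↭-refl ([] ∷ [])
theorem1p4 (suc (suc m)) _ Gs mindeg = choose-or λ x → choose-or λ y → fixed x y
  where
  fixed : ∀ x y → RainbowHamPath Gs (inj₁ x) (inj₂ y) ⊎ _
  fixed x y with ∈⇒↭ (∈-allFin x) | ∈⇒↭ (∈-allFin y)
  ... | Xs , σ | Ys , τ = FixedEnds.dichotomy Gs mindeg x y Xs Ys (↭-sym σ) (↭-sym τ)
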